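{- Let $p\neq 5$ be an odd prime and $q$ a power of $p$. Let $\xi_\kappa,\xi_\lambda$ be primitive $10$-th roots of unity in $GF(q)$ or $GF(q^2)$, and let $\omega_\kappa=\xi_\kappa+\xi_\kappa^{ -1}$, $\omega_\lambda=\xi_\lambda+\xi_\lambda^{ -1}$. Put $D=\omega_\kappa^2+\omega_\lambda^2-4$ and $\eta=(\xi_\kappa-\xi_\kappa^{ -1})^{ -1}$. Then the group $\langle R,S\rangle$ of the regular map of type $(5,5)$, generated by (the classes up to scalars of) the matrices $$R=\begin{pmatrix}\xi_\kappa&0\\0&\xi_\kappa^{ -1}\end{pmatrix},\qquad S=\eta\begin{pmatrix}-\omega_\lambda\xi_\kappa^{ -1}&-D\\1&\omega_\lambda\xi_\kappa\end{pmatrix},$$ is isomorphic to the alternating group $A_5$ if and only if $\omega_\lambda\neq\omega_\kappa$.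
   Context: Matrices are regarded up to nonzero scalar multiples, i.e. as elements of $PGL(2,K)$ with $K$ an algebraic closure of $GF(p)$. The elements $R$ and $S$ represent the rotations of the map around a vertex and around a face; they have order $5$ and $RS$ has order $2$. -}

module Defs where

open import Level using (Level; _⊔_; suc)
open import Algebra.Apartness.Bundles using (HeytingField; HeytingCommutativeRing)
import Algebra.Apartness.Properties.HeytingCommutativeRing as HeytingProperties
open import Algebra.Bundles using (CommutativeRing; Group)
open import Algebra.Morphism.Structures using (module GroupMorphisms)
import Algebra.Definitions.RawMonoid
import Algebra.Properties.Ring
import Algebra.Properties.Semiring.Exp
import Algebra.Properties.Semiring.Mult.TCOptimised
import Algebra.Solver.Ring
open import Algebra.Solver.Ring.AlmostCommutativeRing
  using (fromCommutativeRing; _-Raw-AlmostCommutative⟶_)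
open import Data.Fin.Base using (Fin)
open import Data.Fin.Permutation as Perm using (Permutation′; transpose; _⟨$⟩ʳ_; _∘ₚ_; flip)
open import Data.Fin.Permutation.Transposition.List using (TranspositionList; eval)
open import Data.Integer.Base as ℤ using (ℤ; +_; -[1+_])
import Data.Integer.Properties as ℤₚ
open import Data.List.Base using (List; []; _∷_; _++_; foldr; map; length)
open import Data.List.Properties using (length-++)
open import Data.List.Relation.Unary.All using (All; []; _∷_)
open import Data.List.Relation.Unary.All.Properties using (++⁺)
import Data.Maybe.Base as Maybe
open import Data.Nat.Base as ℕ using (ℕ; _<_; s≤s; z≤n)
open import Data.Nat.Divisibility using (_∣_; ∣m∣n⇒∣m+n; _∣0)
import Data.Nat.Properties as ℕₚ
open import Data.Product.Base using (Σ; Σ-syntax; ∃-syntax; _×_; _,_; proj₁; proj₂)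
open import Data.Sum.Base using (_⊎_; inj₁; inj₂)
open import Function.Base using (_on_)
open import Function.Bundles using (Inverse)
open import Relation.Binary.Consequences using (dec⇒weaklyDec)
import Relation.Binary.Construct.On as On
open import Relation.Binary.PropositionalEquality as ≡ using (_≡_; _≢_)
import Relation.Binary.Reasoning.Setoid as SetoidReasoning
open import Relation.Nullary.Negation using (¬_; contradiction)
open import Relation.Unary using (Pred; _∪_; ｛_｝)

private variable
  c ℓ ℓ₁ ℓ₂ c′ ℓ′ : Level

------------------------------------------------------------------------
-- Groups

record IsSubgroup (G : Group c ℓ) {ℓ′} (P : Pred (Group.Carrier G) ℓ′) : Set (c ⊔ ℓ ⊔ ℓ′) where
  open Group G
  field
    resp      : ∀ {x y} → x ≈ y → P x → P y
    ε-closed  : P ε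
    ∙-closed  : ∀ {x y} → P x → P y → P (x ∙ y)
    ⁻¹-closed : ∀ {x} → P x → P (x ⁻¹)

subgroup : (G : Group c ℓ) {P : Pred (Group.Carrier G) ℓ′} → IsSubgroup G P → Group (c ⊔ ℓ′) ℓ
subgroup G {P} P-subgroup = record
  { Carrier = Σ Carrier P
  ; _≈_     = _≈_ on proj₁
  ; _∙_     = λ (x , Px) (y , Py) → x ∙ y , ∙-closed Px Py
  ; ε       = ε , ε-closed
  ; _⁻¹     = λ (x , Px) → x ⁻¹ , ⁻¹-closed Px
  ; isGroup = record
    { isMonoid = record
      { isSemigroup = record
        { isMagma = record
          { isEquivalence = On.isEquivalence proj₁ isEquivalence
          ; ∙-cong        = ∙-cong
          }
        ; assoc = λ (x , _) (y , _) (z , _) → assoc x y z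
        }
      ; identity = (λ (x , _) → identityˡ x) , (λ (x , _) → identityʳ x)
      }
    ; inverse = (λ (x , _) → inverseˡ x) , (λ (x , _) → inverseʳ x)
    ; ⁻¹-cong = ⁻¹-cong
    }
  }
  where
  open Group G
  open IsSubgroup P-subgroup

data Generated (G : Group c ℓ) {ℓ′} (X : Pred (Group.Carrier G) ℓ′) :
               Pred (Group.Carrier G) (c ⊔ ℓ ⊔ ℓ′) where
  gen      : ∀ {x} → X x → Generated G X x
  respects : ∀ {x y} → Group._≈_ G x y → Generated G X x → Generated G X y
  unit     : Generated G X (Group.ε G)
  mult     : ∀ {x y} → Generated G X x → Generated G X y → Generated G X (Group._∙_ G x y)
  inv      : ∀ {x} → Generated G X x → Generated G X (Group._⁻¹ G x)

generated-isSubgroup : (G : Group c ℓ) (X : Pred (Group.Carrier G) ℓ′) → IsSubgroup G (Generated G X)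
generated-isSubgroup G X = record
  { resp = respects ; ε-closed = unit ; ∙-closed = mult ; ⁻¹-closed = inv }

-- The subgroup of G generated by x and y.
⟨_∣_,_⟩ : (G : Group c ℓ) (x y : Group.Carrier G) → Group (c ⊔ ℓ) ℓ
⟨ G ∣ x , y ⟩ = subgroup G (generated-isSubgroup G (｛ x ｝ ∪ ｛ y ｝))

infix 4 _≅_

_≅_ : Group c ℓ → Group c′ ℓ′ → Set _
G ≅ H = Σ[ f ∈ (Group.Carrier G → Group.Carrier H) ] IsGroupIsomorphism f
  where open GroupMorphisms (Group.rawGroup G) (Group.rawGroup H)

------------------------------------------------------------------------
-- Symmetric and alternating groups

Symmetric : ℕ → Group _ _
Symmetric n = record
  { Carrier = Permutation′ n
  ; _≈_     = Perm._≈_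
  ; _∙_     = _∘ₚ_
  ; ε       = Perm.id
  ; _⁻¹     = flip
  ; isGroup = record
    { isMonoid = record
      { isSemigroup = record
        { isMagma = record
          { isEquivalence = record
            { refl  = λ _ → ≡.refl
            ; sym   = λ π≈ρ i → ≡.sym (π≈ρ i)
            ; trans = λ π≈ρ ρ≈σ i → ≡.trans (π≈ρ i) (ρ≈σ i)
            }
          ; ∙-cong = λ {π} {π′} {ρ} {ρ′} π≈π′ ρ≈ρ′ i →
              ≡.trans (ρ≈ρ′ (π ⟨$⟩ʳ i)) (≡.cong (ρ′ ⟨$⟩ʳ_) (π≈π′ i))
          }
        ; assoc = λ _ _ _ _ → ≡.refl
        }
      ; identity = (λ _ _ → ≡.refl) , (λ _ _ → ≡.refl)
      }
    ; inverse = (λ π _ → Perm.inverseʳ π) , (λ π _ → Perm.inverseˡ π)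
    ; ⁻¹-cong = λ {π} {ρ} π≈ρ i → begin
        flip π ⟨$⟩ʳ i                            ≡⟨ Perm.inverseˡ ρ ⟨
        flip ρ ⟨$⟩ʳ (ρ ⟨$⟩ʳ (flip π ⟨$⟩ʳ i))     ≡⟨ ≡.cong (flip ρ ⟨$⟩ʳ_) (π≈ρ (flip π ⟨$⟩ʳ i)) ⟨
        flip ρ ⟨$⟩ʳ (π ⟨$⟩ʳ (flip π ⟨$⟩ʳ i))     ≡⟨ ≡.cong (flip ρ ⟨$⟩ʳ_) (Perm.inverseʳ π) ⟩
        flip ρ ⟨$⟩ʳ i                            ∎
    }
  }
  where open ≡.≡-Reasoning

-- TranspositionList admits degenerate pairs (i , i), which evaluate to the
-- identity, so these have to be excluded.
IsEven : ∀ {n} → Pred (Permutation′ n) _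
IsEven {n} π = Σ[ ts ∈ TranspositionList n ]
  (All (λ (i , j) → i ≢ j) ts × 2 ∣ length ts × eval ts Perm.≈ π)

private
  eval-++ : ∀ {n} (ts us : TranspositionList n) → eval (ts ++ us) Perm.≈ (eval ts ∘ₚ eval us)
  eval-++ []             us _ = ≡.refl
  eval-++ ((i , j) ∷ ts) us k = eval-++ ts us (transpose i j ⟨$⟩ʳ k)

  invert : ∀ {n} → TranspositionList n → TranspositionList n
  invert []             = []
  invert ((i , j) ∷ ts) = invert ts ++ (j , i) ∷ []

  eval-invert : ∀ {n} (ts : TranspositionList n) → eval (invert ts) Perm.≈ flip (eval ts)
  eval-invert []             _ = ≡.refl
  eval-invert ((i , j) ∷ ts) k =
    ≡.trans (eval-++ (invert ts) _ k) (≡.cong (transpose j i ⟨$⟩ʳ_) (eval-invert ts k))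

  length-invert : ∀ {n} (ts : TranspositionList n) → length (invert ts) ≡ length ts
  length-invert []             = ≡.refl
  length-invert ((i , j) ∷ ts) = ≡.trans (length-++ (invert ts))
    (≡.trans (ℕₚ.+-comm _ 1) (≡.cong ℕ.suc (length-invert ts)))

  All-invert : ∀ {n} {ts : TranspositionList n} →
               All (λ (i , j) → i ≢ j) ts → All (λ (i , j) → i ≢ j) (invert ts)
  All-invert []         = []
  All-invert (i≢j ∷ ps) = ++⁺ (All-invert ps) ((λ j≡i → i≢j (≡.sym j≡i)) ∷ [])

isEven-isSubgroup : ∀ n → IsSubgroup (Symmetric n) IsEven
isEven-isSubgroup n = record
  { resp      = λ π≈ρ (ts , ps , even , ts≈π) → ts , ps , even , λ i → ≡.trans (ts≈π i) (π≈ρ i)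
  ; ε-closed  = [] , [] , 2 ∣0 , λ _ → ≡.refl
  ; ∙-closed  = λ {π} {ρ} (ts , ps , even , ts≈π) (us , qs , even′ , us≈ρ) →
      ts ++ us , ++⁺ ps qs ,
      ≡.subst (2 ∣_) (≡.sym (length-++ ts)) (∣m∣n⇒∣m+n even even′) ,
      λ i → ≡.trans (eval-++ ts us i) (∙-cong {eval ts} {π} {eval us} {ρ} ts≈π us≈ρ i)
  ; ⁻¹-closed = λ {π} (ts , ps , even , ts≈π) →
      invert ts , All-invert ps , ≡.subst (2 ∣_) (≡.sym (length-invert ts)) even ,
      λ i → ≡.trans (eval-invert ts i) (⁻¹-cong {eval ts} {π} ts≈π i)
  }
  where open Group (Symmetric n)

Alternating : ℕ → Group _ _
Alternating n = subgroup (Symmetric n) (isEven-isSubgroup n)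

------------------------------------------------------------------------
-- The commutative ring solver, with integer coefficients

module IntegerRingSolver {c ℓ} (A : CommutativeRing c ℓ) where
  private
    open CommutativeRing A
    open Algebra.Properties.Ring ring
    open Algebra.Properties.Semiring.Mult.TCOptimised semiring
      using (×-homo-+; ×1-homo-*; 1+×) renaming (_×_ to _·_)
    open SetoidReasoning setoid

    ⟦_⟧ : ℤ → Carrier
    ⟦ + n      ⟧ = n · 1#
    ⟦ -[1+ n ] ⟧ = - (ℕ.suc n · 1#)

    -‿homo : ∀ i → ⟦ ℤ.- i ⟧ ≈ - ⟦ i ⟧
    -‿homo (+ 0)       = sym -0#≈0#
    -‿homo (+ ℕ.suc n) = refl
    -‿homo -[1+ n ]    = sym (-‿involutive _)

    ⊖-homo : ∀ m n → ⟦ m ℤ.⊖ n ⟧ ≈ m · 1# - n · 1#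
    ⊖-homo m         0         = sym (trans (+-congˡ -0#≈0#) (+-identityʳ _))
    ⊖-homo 0         (ℕ.suc n) = sym (+-identityˡ _)
    ⊖-homo (ℕ.suc m) (ℕ.suc n) = begin
      ⟦ ℕ.suc m ℤ.⊖ ℕ.suc n ⟧         ≡⟨ ≡.cong ⟦_⟧ (ℤₚ.[1+m]⊖[1+n]≡m⊖n m n) ⟩
      ⟦ m ℤ.⊖ n ⟧                     ≈⟨ ⊖-homo m n ⟩
      m · 1# - n · 1#                 ≈⟨ +-congʳ (xyx⁻¹≈y 1# _) ⟨
      1# + m · 1# - 1# - n · 1#       ≈⟨ +-assoc _ _ _ ⟩
      1# + m · 1# + (- 1# - n · 1#)   ≈⟨ +-congˡ (-‿+-comm 1# _) ⟩
      1# + m · 1# - (1# + n · 1#)     ≈⟨ +-cong (1+× m 1#) (-‿cong (1+× n 1#)) ⟨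
      ℕ.suc m · 1# - ℕ.suc n · 1#     ∎

    +-homo : ∀ i j → ⟦ i ℤ.+ j ⟧ ≈ ⟦ i ⟧ + ⟦ j ⟧
    +-homo (+ m)    (+ n)    = ×-homo-+ 1# m n
    +-homo (+ m)    -[1+ n ] = ⊖-homo m (ℕ.suc n)
    +-homo -[1+ m ] (+ n)    = trans (⊖-homo n (ℕ.suc m)) (+-comm _ _)
    +-homo -[1+ m ] -[1+ n ] = begin
      ⟦ -[1+ m ] ℤ.+ -[1+ n ] ⟧             ≡⟨ ≡.cong ⟦_⟧ (ℤₚ.neg-distrib-+ (+ ℕ.suc m) (+ ℕ.suc n)) ⟨
      ⟦ ℤ.- (+ ℕ.suc m ℤ.+ + ℕ.suc n) ⟧      ≈⟨ -‿homo (+ ℕ.suc m ℤ.+ + ℕ.suc n) ⟩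
      - ⟦ + ℕ.suc m ℤ.+ + ℕ.suc n ⟧          ≈⟨ -‿cong (×-homo-+ 1# (ℕ.suc m) (ℕ.suc n)) ⟩
      - (ℕ.suc m · 1# + ℕ.suc n · 1#)        ≈⟨ -‿+-comm _ _ ⟨
      ⟦ -[1+ m ] ⟧ + ⟦ -[1+ n ] ⟧            ∎

    *-homo-+ : ∀ m j → ⟦ + m ℤ.* j ⟧ ≈ ⟦ + m ⟧ * ⟦ j ⟧
    *-homo-+ m (+ n)    = trans (reflexive (≡.cong ⟦_⟧ (≡.sym (ℤₚ.pos-* m n)))) (×1-homo-* m n)
    *-homo-+ m -[1+ n ] = begin
      ⟦ + m ℤ.* -[1+ n ] ⟧          ≡⟨ ≡.cong ⟦_⟧ (ℤₚ.neg-distribʳ-* (+ m) (+ ℕ.suc n)) ⟨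
      ⟦ ℤ.- (+ m ℤ.* + ℕ.suc n) ⟧   ≈⟨ -‿homo (+ m ℤ.* + ℕ.suc n) ⟩
      - ⟦ + m ℤ.* + ℕ.suc n ⟧       ≈⟨ -‿cong (*-homo-+ m (+ ℕ.suc n)) ⟩
      - (⟦ + m ⟧ * ⟦ + ℕ.suc n ⟧)   ≈⟨ -‿distribʳ-* _ _ ⟩
      ⟦ + m ⟧ * ⟦ -[1+ n ] ⟧        ∎

    *-homo : ∀ i j → ⟦ i ℤ.* j ⟧ ≈ ⟦ i ⟧ * ⟦ j ⟧
    *-homo (+ m)    j = *-homo-+ m j
    *-homo -[1+ m ] j = begin
      ⟦ -[1+ m ] ℤ.* j ⟧            ≡⟨ ≡.cong ⟦_⟧ (ℤₚ.neg-distribˡ-* (+ ℕ.suc m) j) ⟨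
      ⟦ ℤ.- (+ ℕ.suc m ℤ.* j) ⟧     ≈⟨ -‿homo (+ ℕ.suc m ℤ.* j) ⟩
      - ⟦ + ℕ.suc m ℤ.* j ⟧         ≈⟨ -‿cong (*-homo-+ (ℕ.suc m) j) ⟩
      - (⟦ + ℕ.suc m ⟧ * ⟦ j ⟧)     ≈⟨ -‿distribˡ-* _ _ ⟩
      ⟦ -[1+ m ] ⟧ * ⟦ j ⟧          ∎

    morphism : ℤ.+-*-rawRing -Raw-AlmostCommutative⟶ fromCommutativeRing A
    morphism = record
      { ⟦_⟧ = ⟦_⟧ ; +-homo = +-homo ; *-homo = *-homo ; -‿homo = -‿homo
      ; 0-homo = refl ; 1-homo = refl }

  open Algebra.Solver.Ring ℤ.+-*-rawRing (fromCommutativeRing A) morphism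
    (λ i j → Maybe.map (λ i≡j → reflexive (≡.cong ⟦_⟧ i≡j)) (dec⇒weaklyDec ℤₚ._≟_ i j)) public

------------------------------------------------------------------------
-- Fields

-- A field with decidable equality: in a Heyting field, x # y says that
-- x - y is invertible.
record DiscreteField c ℓ₁ ℓ₂ : Set (suc (c ⊔ ℓ₁ ⊔ ℓ₂)) where
  field
    heytingField : HeytingField c ℓ₁ ℓ₂

  open HeytingField heytingField public

  field
    ≈⊎# : ∀ x y → x ≈ y ⊎ x # y

  open HeytingCommutativeRing heytingCommutativeRing public using (commutativeRing)
  open CommutativeRing commutativeRing public using (semiring; +-rawMonoid)
  open Algebra.Definitions.RawMonoid +-rawMonoid public using () renaming (_×_ to _·_)
  open Algebra.Properties.Semiring.Exp semiring public using (_^_)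
  open HeytingProperties heytingCommutativeRing public

  infix 9 _⁻¹

  -- Total, with 0 ⁻¹ = 0.
  _⁻¹ : Carrier → Carrier
  x ⁻¹ with ≈⊎# x 0#
  ... | inj₁ _   = 0#
  ... | inj₂ x#0 = proj₁ (#⇒invertible x#0)

  ⁻¹-inverseʳ : ∀ {x} → x # 0# → x * x ⁻¹ ≈ 1#
  ⁻¹-inverseʳ {x} x#0 with ≈⊎# x 0#
  ... | inj₁ x≈0  = contradiction x#0 (#-irrefl x≈0)
  ... | inj₂ x#0′ = trans (*-congʳ (sym (x-0≈x x))) (proj₂ (proj₂ (#⇒invertible x#0′)))

  ≉⇒# : ∀ {x y} → ¬ (x ≈ y) → x # y
  ≉⇒# {x} {y} x≉y with ≈⊎# x y
  ... | inj₁ x≈y = contradiction x≈y x≉y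
  ... | inj₂ x#y = x#y

module _ (K : DiscreteField c ℓ₁ ℓ₂) where
  open DiscreteField K

  -- monic (a₀ ∷ … ∷ aₙ₋₁ ∷ []) x = a₀ + a₁ x + … + aₙ₋₁ xⁿ⁻¹ + xⁿ
  monic : List Carrier → Carrier → Carrier
  monic as x = foldr (λ a r → a + x * r) 1# as

  -- Since p is prime and p · 1 = 0, the elements n · 1 (n ∈ ℕ) form the copy
  -- of GF(p) in K.
  record IsAlgebraicClosureOfGF (p : ℕ) : Set (c ⊔ ℓ₁) where
    field
      characteristic      : p · 1# ≈ 0#
      algebraicallyClosed : ∀ a as → ∃[ x ] monic (a ∷ as) x ≈ 0#
      algebraic           : ∀ x → Σ[ ns ∈ List ℕ ] monic (map (_· 1#) ns) x ≈ 0#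

  record IsSubfield (F : Pred Carrier ℓ) : Set (c ⊔ ℓ ⊔ ℓ₁ ⊔ ℓ₂) where
    field
      resp      : ∀ {x y} → x ≈ y → F x → F y
      0#-closed : F 0#
      1#-closed : F 1#
      +-closed  : ∀ {x y} → F x → F y → F (x + y)
      *-closed  : ∀ {x y} → F x → F y → F (x * y)
      -‿closed  : ∀ {x} → F x → F (- x)
      ⁻¹-closed : ∀ {x} → x # 0# → F x → F (x ⁻¹)

  -- F is the subfield GF(n) of K.
  record IsGF (n : ℕ) (F : Pred Carrier ℓ) : Set (c ⊔ ℓ ⊔ ℓ₁ ⊔ ℓ₂) where
    field
      isSubfield : IsSubfield F
      order      : Inverse (≡.setoid (Fin n)) (On.setoid {B = Σ Carrier F} setoid proj₁)

  record IsPrimitiveRoot (n : ℕ) (ξ : Carrier) : Set ℓ₁ where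
    field
      root    : ξ ^ n ≈ 1#
      minimal : ∀ m → 0 < m → m < n → ¬ (ξ ^ m ≈ 1#)

------------------------------------------------------------------------
-- The projective linear group

  record Mat₂ : Set c where
    constructor mat
    field
      e₁₁ e₁₂ e₂₁ e₂₂ : Carrier

  open Mat₂

  infix  4 _≈ᴹ_
  infixl 7 _*ᴹ_
  infixr 8 _•_

  record _≈ᴹ_ (A B : Mat₂) : Set ℓ₁ where
    constructor mat≈
    field
      ≈₁₁ : e₁₁ A ≈ e₁₁ B
      ≈₁₂ : e₁₂ A ≈ e₁₂ B
      ≈₂₁ : e₂₁ A ≈ e₂₁ B
      ≈₂₂ : e₂₂ A ≈ e₂₂ B

  _*ᴹ_ : Mat₂ → Mat₂ → Mat₂
  mat a b c d *ᴹ mat a′ b′ c′ d′ =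
    mat (a * a′ + b * c′) (a * b′ + b * d′)
        (c * a′ + d * c′) (c * b′ + d * d′)

  1ᴹ : Mat₂
  1ᴹ = mat 1# 0# 0# 1#

  _•_ : Carrier → Mat₂ → Mat₂
  k • mat a b c d = mat (k * a) (k * b) (k * c) (k * d)

  det : Mat₂ → Carrier
  det (mat a b c d) = a * d - b * c

  adjugate : Mat₂ → Mat₂
  adjugate (mat a b c d) = mat d (- b) (- c) a

  record GL₂ : Set (c ⊔ ℓ₂) where
    constructor gl
    field
      matrix : Mat₂
      det#0  : det matrix # 0#

  open GL₂

  infix 4 _∼_

  _∼_ : GL₂ → GL₂ → Set (c ⊔ ℓ₁ ⊔ ℓ₂)
  A ∼ B = ∃[ k ] (k # 0# × matrix A ≈ᴹ k • matrix B)

  private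
    open IntegerRingSolver commutativeRing
      using (solve; _:=_; _:+_; _:*_; _:-_; :-_; con)

    ≈-#0 : ∀ {x y} → x ≈ y → y # 0# → x # 0#
    ≈-#0 x≈y = #-congʳ (sym x≈y)

    det-*ᴹ : ∀ A B → det (A *ᴹ B) ≈ det A * det B
    det-*ᴹ (mat a b c d) (mat a′ b′ c′ d′) = identity a b c d a′ b′ c′ d′
      where
      identity : ∀ a b c d a′ b′ c′ d′ →
        (a * a′ + b * c′) * (c * b′ + d * d′) - (a * b′ + b * d′) * (c * a′ + d * c′)
          ≈ (a * d - b * c) * (a′ * d′ - b′ * c′)
      identity = solve 8 (λ a b c d a′ b′ c′ d′ →
          (a :* a′ :+ b :* c′) :* (c :* b′ :+ d :* d′) :- (a :* b′ :+ b :* d′) :* (c :* a′ :+ d :* c′)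
            := (a :* d :- b :* c) :* (a′ :* d′ :- b′ :* c′)) refl

    det-adjugate : ∀ A → det (adjugate A) ≈ det A
    det-adjugate (mat a b c d) = identity a b c d
      where
      identity : ∀ a b c d → d * a - (- b) * (- c) ≈ a * d - b * c
      identity = solve 4 (λ a b c d →
        d :* a :- (:- b) :* (:- c) := a :* d :- b :* c) refl

    det-1ᴹ : det 1ᴹ ≈ 1#
    det-1ᴹ = solve 0 (con (+ 1) :* con (+ 1) :- con (+ 0) :* con (+ 0) := con (+ 1)) refl

    ⁻¹#0 : ∀ {x} → x # 0# → x ⁻¹ # 0#
    ⁻¹#0 {x} x#0 = invertibleˡ⇒# (x , trans (*-congˡ (x-0≈x (x ⁻¹))) (⁻¹-inverseʳ x#0))

    ∼-refl : ∀ {A} → A ∼ A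
    ∼-refl = 1# , 1#0 , mat≈ 1x 1x 1x 1x
      where
      1x : ∀ {x} → x ≈ 1# * x
      1x {x} = sym (*-identityˡ x)

    ∼-sym : ∀ {A B} → A ∼ B → B ∼ A
    ∼-sym (k , k#0 , mat≈ p q r s) = k ⁻¹ , ⁻¹#0 k#0 , mat≈ (f p) (f q) (f r) (f s)
      where
      open SetoidReasoning setoid
      f : ∀ {x y} → x ≈ k * y → y ≈ k ⁻¹ * x
      f {x} {y} x≈ky = begin
        y                ≈⟨ *-identityˡ y ⟨
        1# * y           ≈⟨ *-congʳ (⁻¹-inverseʳ k#0) ⟨
        k * k ⁻¹ * y     ≈⟨ *-congʳ (*-comm k (k ⁻¹)) ⟩
        k ⁻¹ * k * y     ≈⟨ *-assoc (k ⁻¹) k y ⟩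
        k ⁻¹ * (k * y)   ≈⟨ *-congˡ x≈ky ⟨
        k ⁻¹ * x         ∎

    ∼-trans : ∀ {A B C} → A ∼ B → B ∼ C → A ∼ C
    ∼-trans (k , k#0 , mat≈ p q r s) (l , l#0 , mat≈ p′ q′ r′ s′) =
      k * l , x#0y#0→xy#0 k#0 l#0 , mat≈ (f p p′) (f q q′) (f r r′) (f s s′)
      where
      f : ∀ {x y z} → x ≈ k * y → y ≈ l * z → x ≈ k * l * z
      f x≈ky y≈lz = trans x≈ky (trans (*-congˡ y≈lz) (sym (*-assoc k l _)))

    ≈ᴹ⇒∼ : ∀ {A B} → matrix A ≈ᴹ matrix B → A ∼ B
    ≈ᴹ⇒∼ (mat≈ p q r s) = 1# , 1#0 , mat≈ (f p) (f q) (f r) (f s)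
      where
      f : ∀ {x y} → x ≈ y → x ≈ 1# * y
      f {y = y} x≈y = trans x≈y (sym (*-identityˡ y))

  infixl 7 _∙_

  _∙_ : GL₂ → GL₂ → GL₂
  gl A A#0 ∙ gl B B#0 = gl (A *ᴹ B) (≈-#0 (det-*ᴹ A B) (x#0y#0→xy#0 A#0 B#0))

  identityGL₂ : GL₂
  identityGL₂ = gl 1ᴹ (≈-#0 det-1ᴹ 1#0)

  -- Up to the scalar det A, the adjugate is the inverse matrix.
  inverseGL₂ : GL₂ → GL₂
  inverseGL₂ (gl A A#0) = gl (adjugate A) (≈-#0 (det-adjugate A) A#0)

  private
    ∙-cong : ∀ {A A′ B B′} → A ∼ A′ → B ∼ B′ → A ∙ B ∼ A′ ∙ B′
    ∙-cong (k , k#0 , mat≈ p q r s) (l , l#0 , mat≈ p′ q′ r′ s′) =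
      k * l , x#0y#0→xy#0 k#0 l#0 ,
      mat≈ (f p p′ q r′) (f p q′ q s′) (f r p′ s r′) (f r q′ s s′)
      where
      identity : ∀ k l x y z w →
        k * x * (l * y) + k * z * (l * w) ≈ k * l * (x * y + z * w)
      identity = solve 6 (λ k l x y z w →
        k :* x :* (l :* y) :+ k :* z :* (l :* w) := k :* l :* (x :* y :+ z :* w)) refl

      f : ∀ {x x′ y y′ z z′ w w′} → x ≈ k * x′ → y ≈ l * y′ → z ≈ k * z′ → w ≈ l * w′ →
          x * y + z * w ≈ k * l * (x′ * y′ + z′ * w′)
      f xx yy zz ww = trans (+-cong (*-cong xx yy) (*-cong zz ww)) (identity k l _ _ _ _)

    ⁻¹-cong : ∀ {A B} → A ∼ B → inverseGL₂ A ∼ inverseGL₂ B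
    ⁻¹-cong (k , k#0 , mat≈ p q r s) = k , k#0 , mat≈ s (f q) (f r) p
      where
      identity : ∀ k x → - (k * x) ≈ k * (- x)
      identity = solve 2 (λ k x →
        :- (k :* x) := k :* (:- x)) refl

      f : ∀ {x y} → x ≈ k * y → - x ≈ k * (- y)
      f x≈ky = trans (-‿cong x≈ky) (identity k _)

    assoc : ∀ A B C → (A ∙ B) ∙ C ∼ A ∙ (B ∙ C)
    assoc (gl (mat a b c d) p) (gl (mat a′ b′ c′ d′) q) (gl (mat a″ b″ c″ d″) r) =
      ≈ᴹ⇒∼ {(A ∙ B) ∙ C} {A ∙ (B ∙ C)}
        (mat≈ (f a b a′ b′ c′ d′ a″ c″) (f a b a′ b′ c′ d′ b″ d″)
              (f c d a′ b′ c′ d′ a″ c″) (f c d a′ b′ c′ d′ b″ d″))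
      where
      A = gl (mat a b c d) p
      B = gl (mat a′ b′ c′ d′) q
      C = gl (mat a″ b″ c″ d″) r

      f : ∀ x y a′ b′ c′ d′ z w →
        (x * a′ + y * c′) * z + (x * b′ + y * d′) * w ≈ x * (a′ * z + b′ * w) + y * (c′ * z + d′ * w)
      f = solve 8 (λ x y a′ b′ c′ d′ z w →
          (x :* a′ :+ y :* c′) :* z :+ (x :* b′ :+ y :* d′) :* w
          := x :* (a′ :* z :+ b′ :* w) :+ y :* (c′ :* z :+ d′ :* w)) refl

    identityˡ : ∀ A → identityGL₂ ∙ A ∼ A
    identityˡ A@(gl (mat a b c d) _) = ≈ᴹ⇒∼ {identityGL₂ ∙ A} {A} (mat≈ (f a c) (f b d) (g a c) (g b d))
      where
      f : ∀ x y → 1# * x + 0# * y ≈ x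
      f = solve 2 (λ x y →
        con (+ 1) :* x :+ con (+ 0) :* y := x) refl
      g : ∀ x y → 0# * x + 1# * y ≈ y
      g = solve 2 (λ x y →
        con (+ 0) :* x :+ con (+ 1) :* y := y) refl

    identityʳ : ∀ A → A ∙ identityGL₂ ∼ A
    identityʳ A@(gl (mat a b c d) _) = ≈ᴹ⇒∼ {A ∙ identityGL₂} {A} (mat≈ (f a b) (g a b) (f c d) (g c d))
      where
      f : ∀ x y → x * 1# + y * 0# ≈ x
      f = solve 2 (λ x y →
        x :* con (+ 1) :+ y :* con (+ 0) := x) refl
      g : ∀ x y → x * 0# + y * 1# ≈ y
      g = solve 2 (λ x y →
        x :* con (+ 0) :+ y :* con (+ 1) := y) refl

    inverseˡ : ∀ A → inverseGL₂ A ∙ A ∼ identityGL₂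
    inverseˡ A@(gl (mat a b c d) A#0) = det (matrix A) , A#0 ,
      mat≈ (f a b c d) (g a b c d b d) (h a b c d a c) (k a b c d)
      where
      f : ∀ a b c d → d * a + (- b) * c ≈ (a * d - b * c) * 1#
      f = solve 4 (λ a b c d →
        d :* a :+ (:- b) :* c := (a :* d :- b :* c) :* con (+ 1)) refl
      g : ∀ a b c d x y → y * x + (- x) * y ≈ (a * d - b * c) * 0#
      g = solve 6 (λ a b c d x y →
        y :* x :+ (:- x) :* y := (a :* d :- b :* c) :* con (+ 0)) refl
      h : ∀ a b c d x y → (- y) * x + x * y ≈ (a * d - b * c) * 0#
      h = solve 6 (λ a b c d x y →
        (:- y) :* x :+ x :* y := (a :* d :- b :* c) :* con (+ 0)) refl
      k : ∀ a b c d → (- c) * b + a * d ≈ (a * d - b * c) * 1#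
      k = solve 4 (λ a b c d →
        (:- c) :* b :+ a :* d := (a :* d :- b :* c) :* con (+ 1)) refl

    inverseʳ : ∀ A → A ∙ inverseGL₂ A ∼ identityGL₂
    inverseʳ A@(gl (mat a b c d) A#0) = det (matrix A) , A#0 ,
      mat≈ (f a b c d) (g a b c d a b) (h a b c d c d) (k a b c d)
      where
      f : ∀ a b c d → a * d + b * (- c) ≈ (a * d - b * c) * 1#
      f = solve 4 (λ a b c d →
        a :* d :+ b :* (:- c) := (a :* d :- b :* c) :* con (+ 1)) refl
      g : ∀ a b c d x y → x * (- y) + y * x ≈ (a * d - b * c) * 0#
      g = solve 6 (λ a b c d x y →
        x :* (:- y) :+ y :* x := (a :* d :- b :* c) :* con (+ 0)) refl
      h : ∀ a b c d x y → x * y + y * (- x) ≈ (a * d - b * c) * 0#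
      h = solve 6 (λ a b c d x y →
        x :* y :+ y :* (:- x) := (a :* d :- b :* c) :* con (+ 0)) refl
      k : ∀ a b c d → c * (- b) + d * a ≈ (a * d - b * c) * 1#
      k = solve 4 (λ a b c d →
        c :* (:- b) :+ d :* a := (a :* d :- b :* c) :* con (+ 1)) refl

  PGL₂ : Group (c ⊔ ℓ₂) (c ⊔ ℓ₁ ⊔ ℓ₂)
  PGL₂ = record
    { Carrier = GL₂
    ; _≈_     = _∼_
    ; _∙_     = _∙_
    ; ε       = identityGL₂
    ; _⁻¹     = inverseGL₂
    ; isGroup = record
      { isMonoid = record
        { isSemigroup = record
          { isMagma = record
            { isEquivalence = record
              { refl  = λ {A} → ∼-refl {A}
              ; sym   = λ {A} {B} → ∼-sym {A} {B}
              ; trans = λ {A} {B} {C} → ∼-trans {A} {B} {C}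
              }
            ; ∙-cong = λ {A} {A′} {B} {B′} → ∙-cong {A} {A′} {B} {B′}
            }
          ; assoc = assoc
          }
        ; identity = identityˡ , identityʳ
        }
      ; inverse = inverseˡ , inverseʳ
      ; ⁻¹-cong = λ {A} {B} → ⁻¹-cong {A} {B}
      }
    }

------------------------------------------------------------------------
-- The generators

  ω : Carrier → Carrier
  ω ξ = ξ + ξ ⁻¹

  D : (ξκ ξλ : Carrier) → Carrier
  D ξκ ξλ = ω ξκ ^ 2 + ω ξλ ^ 2 - 4 · 1#

  η : Carrier → Carrier
  η ξκ = (ξκ - ξκ ⁻¹) ⁻¹

  R-matrix : Carrier → Mat₂
  R-matrix ξκ = mat ξκ 0#
                    0# (ξκ ⁻¹)

  S-matrix : (ξκ ξλ : Carrier) → Mat₂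
  S-matrix ξκ ξλ = η ξκ • mat (- ω ξλ * ξκ ⁻¹) (- D ξκ ξλ)
                              1#                (ω ξλ * ξκ)

  module _ {ξ : Carrier} (ξ-primitive : IsPrimitiveRoot 10 ξ) where
    open IsPrimitiveRoot ξ-primitive
    open SetoidReasoning setoid

    private
      ξ#0 : ξ # 0#
      ξ#0 = invertibleʳ⇒# (ξ ^ 9 , trans (*-congʳ (x-0≈x ξ)) root)

      ξξ⁻¹≈1 : ξ * ξ ⁻¹ ≈ 1#
      ξξ⁻¹≈1 = ⁻¹-inverseʳ ξ#0

      ξ-ξ⁻¹#0 : ξ - ξ ⁻¹ # 0#
      ξ-ξ⁻¹#0 = ≉⇒# λ ξ-ξ⁻¹≈0 → minimal 2 (s≤s z≤n) (s≤s (s≤s (s≤s z≤n))) (begin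
        ξ ^ 2                             ≈⟨ identity ξ (ξ ⁻¹) ⟩
        ξ * (ξ - ξ ⁻¹) + ξ * ξ ⁻¹         ≈⟨ +-cong (*-congˡ ξ-ξ⁻¹≈0) ξξ⁻¹≈1 ⟩
        ξ * 0# + 1#                       ≈⟨ +-congʳ (zeroʳ ξ) ⟩
        0# + 1#                           ≈⟨ +-identityˡ 1# ⟩
        1#                                ∎)
        where
        identity : ∀ x y → x * (x * 1#) ≈ x * (x - y) + x * y
        identity = solve 2 (λ x y →
          x :* (x :* con (+ 1)) := x :* (x :- y) :+ x :* y) refl

      det-R : det (R-matrix ξ) ≈ 1#
      det-R = trans (identity (ξ * ξ ⁻¹)) ξξ⁻¹≈1
        where
        identity : ∀ x → x - 0# * 0# ≈ x
        identity = solve 1 (λ x →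
          x :- con (+ 0) :* con (+ 0) := x) refl

      det-S : ∀ ξλ → det (S-matrix ξ ξλ) ≈ 1#
      det-S ξλ = begin
        det (S-matrix ξ ξλ)
          ≈⟨ identity (η ξ) (ω ξλ) ξ (ξ ⁻¹) ⟩
        ((ξ - ξ ⁻¹) * η ξ) * ((ξ - ξ ⁻¹) * η ξ) + k * (1# - ξ * ξ ⁻¹)
          ≈⟨ +-cong (*-cong ηη ηη) (*-congˡ (+-congˡ (-‿cong ξξ⁻¹≈1))) ⟩
        1# * 1# + k * (1# - 1#)
          ≈⟨ identity′ k ⟩
        1# ∎
        where
        k = η ξ * η ξ * (ω ξλ * ω ξλ - (1# + 1# + 1# + 1#))

        ηη : (ξ - ξ ⁻¹) * η ξ ≈ 1#
        ηη = ⁻¹-inverseʳ ξ-ξ⁻¹#0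

        identity : ∀ h w x y →
          (h * (- w * y)) * (h * (w * x))
            - (h * - ((x + y) * ((x + y) * 1#) + w * (w * 1#) - (1# + (1# + (1# + (1# + 0#)))))) * (h * 1#)
          ≈ ((x - y) * h) * ((x - y) * h) + h * h * (w * w - (1# + 1# + 1# + 1#)) * (1# - x * y)
        identity = solve 4 (λ h w x y →
            (h :* (:- w :* y)) :* (h :* (w :* x))
              :- (h :* :- ((x :+ y) :* ((x :+ y) :* con (+ 1)) :+ w :* (w :* con (+ 1))
                         :- (con (+ 1) :+ (con (+ 1) :+ (con (+ 1) :+ (con (+ 1) :+ con (+ 0)))))))
              :* (h :* con (+ 1))
              := ((x :- y) :* h) :* ((x :- y) :* h)
                 :+ h :* h :* (w :* w :- (con (+ 1) :+ con (+ 1) :+ con (+ 1) :+ con (+ 1))) :* (con (+ 1) :- x :* y)) refl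

        identity′ : ∀ k → 1# * 1# + k * (1# - 1#) ≈ 1#
        identity′ = solve 1 (λ k →
            con (+ 1) :* con (+ 1) :+ k :* (con (+ 1) :- con (+ 1))
         := con (+ 1)) refl

    R : GL₂
    R = gl (R-matrix ξ) (≈-#0 det-R 1#0)

    S : Carrier → GL₂
    S ξλ = gl (S-matrix ξ ξλ) (≈-#0 (det-S ξλ) 1#0)

{-# OPTIONS --safe #-}

-- Both ωκ and ωλ are roots of x² = x + 1, so either ωλ = ωκ or ωλ = 1 − ωκ.
-- In both cases R and S are, up to scalars, matrices over ℤ[ω, ξ] with
-- ω² = ω + 1 and ξ² = ωξ − 1, independently of the characteristic, and whether
-- a word in R and S is scalar is decided by computing in this ring: the entries
-- that have to be nonzero have norms dividing a power of 10.
--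
-- If ωλ = 1 − ωκ, the elements of A₅ are the values of 60 words in two
-- 5-cycles r and s; the same 60 words in R and S satisfy the same
-- multiplication table, and only the empty one is scalar.
--
-- If ωλ = ωκ, then R, S have order 5, RS has order 2, but (RS⁻¹)³ ≠ 1, because
-- RS⁻¹ has trace ωκ² and ωκ⁴ − 1 = 3ωκ + 1 has norm −5.  In A₅ these relations
-- force (RS⁻¹)³ = 1.
module Submission where

open import Algebra.Bundles using (Group)
open import Algebra.Bundles.Raw using (RawRing)
import Algebra.Construct.DirectProduct as DirectProduct
open import Algebra.Morphism.Structures using (module GroupMorphisms)
import Algebra.Properties.Group as GroupProperties
open import Algebra.Solver.Ring.AlmostCommutativeRing
  using (fromCommutativeRing; _-Raw-AlmostCommutative⟶_)
open import Data.Fin.Base using (Fin)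
open import Data.Fin.Patterns using (0F; 1F; 2F; 3F; 4F)
open import Data.Fin.Permutation using (_⟨$⟩ʳ_)
open import Data.Fin.Permutation.Transposition.List using (TranspositionList; eval)
import Data.Fin.Properties as Fin
open import Data.Integer.Base as ℤ using (ℤ; +_; -[1+_])
import Data.Integer.Divisibility.Signed as ℤ
import Data.Integer.Properties as ℤ
open import Data.List.Base using (List; []; _∷_; _++_; foldr; map; replicate; cartesianProductWith; concat; length)
open import Data.List.Membership.Propositional using (find; lose) renaming (_∈_ to _∈ᴸ_)
open import Data.List.Relation.Unary.All as All using (All; []; _∷_)
open import Data.List.Relation.Unary.Any as Any using (Any; here)
open import Data.Nat.Base using (ℕ; _≤_; _^_; zero; suc; s≤s; z≤n)
open import Data.Nat.Divisibility using (_∤_; _∣_; divides-refl; ∣m+n∣m⇒∣n; ∣1⇒≡1)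
open import Data.Nat.Primality using (Prime)
open import Data.Product.Base using (Σ; Σ-syntax; _×_; _,_; proj₁; proj₂)
import Data.Product.Properties as Product
open import Data.Sum.Base as Sum using (_⊎_; inj₁; inj₂; [_,_]′)
open import Data.Vec.Base using ([]; _∷_)
open import Function.Base using (_∘_)
open import Function.Bundles using (_⇔_; mk⇔; Equivalence)
open import Level using (Level; 0ℓ; _⊔_)
open import Relation.Binary.Definitions using (DecidableEquality)
open import Relation.Binary.PropositionalEquality as ≡ using (_≡_; _≢_)
import Relation.Binary.Reasoning.Setoid as SetoidReasoning
open import Relation.Nullary.Decidable using (Dec; _×-dec_; _⊎-dec_; _→-dec_; ¬?; toWitness)
open import Relation.Nullary.Negation using (¬_; contradiction)
open import Relation.Unary using (Pred; _∈_; _∪_; ｛_｝)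
open import Defs hiding (_∙_)

private variable
  a b c ℓ ℓ′ ℓ₁ ℓ₂ : Level

-- Words in two generators of a group

data Letter : Set where
  ρ σ : Letter

Word : Set
Word = List Letter

letter : {A : Set a} → A → A → Letter → A
letter x y ρ = x
letter x y σ = y

evaluate : {A : Set a} → (A → A → A) → A → A → A → Word → A
evaluate _∙_ ε x y = foldr (λ l z → letter x y l ∙ z) ε

infixr 8 _^ᵂ_

_^ᵂ_ : Word → ℕ → Word
w ^ᵂ n = concat (replicate n w)

-- Representatives of the elements of A₅.  The four summands are the double
-- cosets of ⟨ρ⟩, of size 5, 25, 25 and 5.
words : List Word
words = cartesianProductWith _++_ (powers ρ)
  ([] ∷ map (σ ∷_) (powers ρ) ++ map (λ w → σ ∷ σ ∷ w) (powers ρ) ++ (σ ∷ ρ ∷ ρ ∷ σ ∷ σ ∷ []) ∷ [])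
  where
  powers : Letter → List Word
  powers l = map (λ n → replicate n l) (0 ∷ 1 ∷ 2 ∷ 3 ∷ 4 ∷ [])

module Words (G : Group a ℓ) (x y : Group.Carrier G) where
  open Group G
  open GroupProperties G

  ⟦_⟧ˡ : Letter → Carrier
  ⟦_⟧ˡ = letter x y

  ⟦_⟧ : Word → Carrier
  ⟦_⟧ = evaluate _∙_ ε x y

  Generators : Pred Carrier a
  Generators = ｛ x ｝ ∪ ｛ y ｝

  generated : ∀ w → Generated G Generators ⟦ w ⟧
  generated []      = unit
  generated (ρ ∷ w) = mult (gen (inj₁ ≡.refl)) (generated w)
  generated (σ ∷ w) = mult (gen (inj₂ ≡.refl)) (generated w)

  module Enumeration
    (ws : List Word) ([]∈ws : [] ∈ᴸ ws)
    (closed : ∀ l → All (λ u → Any (λ v → ⟦ u ⟧ ∙ ⟦ l ⟧ˡ ≈ ⟦ v ⟧) ws) ws)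
    (inverse : All (λ u → Any (λ v → ⟦ u ⟧ ∙ ⟦ v ⟧ ≈ ε) ws) ws)
    where

    Listed : Pred Carrier ℓ
    Listed z = Any (λ u → z ≈ ⟦ u ⟧) ws

    listed-resp : ∀ {z z′} → z ≈ z′ → Listed z → Listed z′
    listed-resp z≈z′ = Any.map (trans (sym z≈z′))

    listed-∙ˡ : ∀ {z} l → Listed z → Listed (z ∙ ⟦ l ⟧ˡ)
    listed-∙ˡ l z∈ with find z∈
    ... | u , u∈ws , z≈u = Any.map (trans (∙-congʳ z≈u))
                             (All.lookup (closed l) u∈ws)

    listed-∙ᵂ : ∀ {z} w → Listed z → Listed (z ∙ ⟦ w ⟧)
    listed-∙ᵂ []      z∈ = listed-resp (sym (identityʳ _)) z∈
    listed-∙ᵂ (l ∷ w) z∈ = listed-resp (assoc _ _ _) (listed-∙ᵂ w (listed-∙ˡ l z∈))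

    -- Once the right factor of a product is known to be a word, `closed` absorbs it letter by
    -- letter. Closure under letters alone yields a monoid; for `inv`, a right inverse found in the
    -- list is the inverse by uniqueness.
    listed : ∀ {z} → Generated G Generators z → Listed z
    listed (gen {z} (inj₁ ≡.refl)) = listed-resp (identityˡ z) (listed-∙ˡ ρ (lose []∈ws refl))
    listed (gen {z} (inj₂ ≡.refl)) = listed-resp (identityˡ z) (listed-∙ˡ σ (lose []∈ws refl))
    listed (respects z≈z′ g) = listed-resp z≈z′ (listed g)
    listed unit = lose []∈ws refl
    listed (mult g h) with find (listed h)
    ... | w , _ , z≈w = listed-resp (∙-congˡ (sym z≈w)) (listed-∙ᵂ w (listed g))
    listed (inv g) with find (listed g)
    ... | u , u∈ws , z≈u = Any.map (λ uv → trans (⁻¹-cong z≈u) (sym (inverseʳ-unique _ _ uv)))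
                             (All.lookup inverse u∈ws)

-- Comparing two groups word by word

module _ (G : Group a ℓ) (H : Group b ℓ′) where
  private
    module G = Group G
    module H = Group H

  evaluate-homo : (f : G.Carrier → H.Carrier) →
    f G.ε H.≈ H.ε → (∀ x y → f (x G.∙ y) H.≈ f x H.∙ f y) →
    ∀ {x y x′ y′} → f x H.≈ x′ → f y H.≈ y′ →
    ∀ w → f (Words.⟦_⟧ G x y w) H.≈ Words.⟦_⟧ H x′ y′ w
  evaluate-homo f ε-homo homo fx≈ fy≈ []      = ε-homo
  evaluate-homo f ε-homo homo fx≈ fy≈ (ρ ∷ w) =
    H.trans (homo _ _) (H.∙-cong fx≈ (evaluate-homo f ε-homo homo fx≈ fy≈ w))
  evaluate-homo f ε-homo homo fx≈ fy≈ (σ ∷ w) =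
    H.trans (homo _ _) (H.∙-cong fy≈ (evaluate-homo f ε-homo homo fx≈ fy≈ w))

  -- The subgroup of G × H generated by (x , x′) and (y , y′) consists of the
  -- values of ws, so it is the graph of an isomorphism.
  module GraphIsomorphism (x y : G.Carrier) (x′ y′ : H.Carrier) where
    module ⟨G⟩ = Words G x y
    module ⟨H⟩ = Words H x′ y′

    G×H : Group _ _
    G×H = DirectProduct.group G H

    module G×H = Group G×H
    module ⟨G×H⟩ = Words G×H (x , x′) (y , y′)

    -- Evaluation in `G×H` is stuck on a variable word, so it splits into components only
    -- propositionally; hence the rewriting below.
    pair : ∀ w → ⟨G×H⟩.⟦ w ⟧ ≡ (⟨G⟩.⟦ w ⟧ , ⟨H⟩.⟦ w ⟧)
    pair []      = ≡.refl
    pair (ρ ∷ w) = ≡.cong ((x , x′) G×H.∙_) (pair w)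
    pair (σ ∷ w) = ≡.cong ((y , y′) G×H.∙_) (pair w)

    pairˡ : ∀ l → ⟨G×H⟩.⟦ l ⟧ˡ ≡ (⟨G⟩.⟦ l ⟧ˡ , ⟨H⟩.⟦ l ⟧ˡ)
    pairˡ ρ = ≡.refl
    pairˡ σ = ≡.refl

    module _
      (ws : List Word) ([]∈ws : [] ∈ᴸ ws)
      (closed : ∀ l → All (λ u → Any (λ v →
        ⟨G⟩.⟦ u ⟧ G.∙ ⟨G⟩.⟦ l ⟧ˡ G.≈ ⟨G⟩.⟦ v ⟧ × ⟨H⟩.⟦ u ⟧ H.∙ ⟨H⟩.⟦ l ⟧ˡ H.≈ ⟨H⟩.⟦ v ⟧) ws) ws)
      (inverse : All (λ u → Any (λ v →
        ⟨G⟩.⟦ u ⟧ G.∙ ⟨G⟩.⟦ v ⟧ G.≈ G.ε × ⟨H⟩.⟦ u ⟧ H.∙ ⟨H⟩.⟦ v ⟧ H.≈ H.ε) ws) ws)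
      (faithful : All (λ u → ⟨G⟩.⟦ u ⟧ G.≈ G.ε ⇔ ⟨H⟩.⟦ u ⟧ H.≈ H.ε) ws)
      (generated : ∀ h → Generated H ⟨H⟩.Generators h)
      where

      closed-× : ∀ l u v →
        (⟨G⟩.⟦ u ⟧ G.∙ ⟨G⟩.⟦ l ⟧ˡ G.≈ ⟨G⟩.⟦ v ⟧ × ⟨H⟩.⟦ u ⟧ H.∙ ⟨H⟩.⟦ l ⟧ˡ H.≈ ⟨H⟩.⟦ v ⟧) →
        ⟨G×H⟩.⟦ u ⟧ G×H.∙ ⟨G×H⟩.⟦ l ⟧ˡ G×H.≈ ⟨G×H⟩.⟦ v ⟧
      closed-× l u v uv rewrite pair u | pairˡ l | pair v = uv

      inverse-× : ∀ u v →
        (⟨G⟩.⟦ u ⟧ G.∙ ⟨G⟩.⟦ v ⟧ G.≈ G.ε × ⟨H⟩.⟦ u ⟧ H.∙ ⟨H⟩.⟦ v ⟧ H.≈ H.ε) →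
        ⟨G×H⟩.⟦ u ⟧ G×H.∙ ⟨G×H⟩.⟦ v ⟧ G×H.≈ G×H.ε
      inverse-× u v uv rewrite pair u | pair v = uv

      ws-closed : ∀ l → All (λ u → Any (λ v →
        ⟨G×H⟩.⟦ u ⟧ G×H.∙ ⟨G×H⟩.⟦ l ⟧ˡ G×H.≈ ⟨G×H⟩.⟦ v ⟧) ws) ws
      ws-closed l = All.map (λ {u} → Any.map (λ {v} → closed-× l u v)) (closed l)

      ws-inverse : All (λ u → Any (λ v → ⟨G×H⟩.⟦ u ⟧ G×H.∙ ⟨G×H⟩.⟦ v ⟧ G×H.≈ G×H.ε) ws) ws
      ws-inverse = All.map (λ {u} → Any.map (λ {v} → inverse-× u v)) inverse

      open ⟨G×H⟩.Enumeration ws []∈ws ws-closed ws-inverse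

      -- The recursion is on the derivation of `z`, not on `z` itself. That derivations of equal
      -- elements have equal images is part of `image-injective`.
      image : ∀ {z} → Generated G ⟨G⟩.Generators z → H.Carrier
      image (gen (inj₁ _))   = x′
      image (gen (inj₂ _))   = y′
      image (respects _ g)   = image g
      image unit             = H.ε
      image (mult g h)       = image g H.∙ image h
      image (inv g)          = image g H.⁻¹

      graph : ∀ {z} (g : Generated G ⟨G⟩.Generators z) → Generated G×H ⟨G×H⟩.Generators (z , image g)
      graph (gen (inj₁ ≡.refl)) = gen (inj₁ ≡.refl)
      graph (gen (inj₂ ≡.refl)) = gen (inj₂ ≡.refl)
      graph (respects z≈z′ g)   = respects (z≈z′ , H.refl) (graph g)
      graph unit                = unit
      graph (mult g h)          = mult (graph g) (graph h)
      graph (inv g)             = inv (graph g)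

      -- By `graph` and `listed`, a single word `u` of `ws` evaluates to `z` in `G` and to `image g`
      -- in `H`; for `u` the claim is `faithful`.
      image-faithful : ∀ {z} (g : Generated G ⟨G⟩.Generators z) → z G.≈ G.ε ⇔ image g H.≈ H.ε
      image-faithful {z} g with find (listed (graph g))
      ... | u , u∈ws , z,g≈u = mk⇔
        (λ z≈ε → H.trans (proj₂ zg≈u) (to (G.trans (G.sym (proj₁ zg≈u)) z≈ε)))
        (λ g≈ε → G.trans (proj₁ zg≈u) (from (H.trans (H.sym (proj₂ zg≈u)) g≈ε)))
        where
        open Equivalence (All.lookup faithful u∈ws)
        zg≈u : (z , image g) G×H.≈ (⟨G⟩.⟦ u ⟧ , ⟨H⟩.⟦ u ⟧)
        zg≈u = ≡.subst ((z , image g) G×H.≈_) (pair u) z,g≈u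

      preimage : ∀ {h} → Generated H ⟨H⟩.Generators h →
        Σ[ z ∈ Σ G.Carrier (Generated G ⟨G⟩.Generators) ] image (proj₂ z) H.≈ h
      preimage (gen (inj₁ ≡.refl)) = (x , gen (inj₁ ≡.refl)) , H.refl
      preimage (gen (inj₂ ≡.refl)) = (y , gen (inj₂ ≡.refl)) , H.refl
      preimage (respects h≈h′ g)   = let z , eq = preimage g in z , H.trans eq h≈h′
      preimage unit                = (G.ε , unit) , H.refl
      preimage (mult g h)          =
        let (z , gz) , p = preimage g
            (t , gt) , q = preimage h
        in (z G.∙ t , mult gz gt) , H.∙-cong p q
      preimage (inv g)             = let (z , gz) , p = preimage g in (z G.⁻¹ , inv gz) , H.⁻¹-cong p

      -- Apply `image-faithful` to z t⁻¹: the image of the derivation `mult g (inv h)` is by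
      -- definition the quotient of the two images.
      image-injective : ∀ {z t} (g : Generated G ⟨G⟩.Generators z) (h : Generated G ⟨G⟩.Generators t) →
                   z G.≈ t ⇔ image g H.≈ image h
      image-injective {z} {t} g h = mk⇔
        (λ z≈t → x∙y⁻¹≈ε⇒x≈y H _ _ (to (x≈y⇒x∙y⁻¹≈ε G z≈t)))
        (λ g≈h → x∙y⁻¹≈ε⇒x≈y G _ _ (from (x≈y⇒x∙y⁻¹≈ε H g≈h)))
        where
        open GroupProperties
        open Equivalence (image-faithful (mult g (inv h)))

      isomorphism : ⟨ G ∣ x , y ⟩ ≅ H
      isomorphism = image ∘ proj₂ , record
        { isGroupMonomorphism = record
          { isGroupHomomorphism = record
            { isMonoidHomomorphism = record
              { isMagmaHomomorphism = record
                { isRelHomomorphism = record { cong = λ {(_ , g)} {(_ , h)} → Equivalence.to (image-injective g h) }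
                ; homo = λ _ _ → H.refl
                }
              ; ε-homo = H.refl
              }
            ; ⁻¹-homo = λ _ → H.refl
            }
          ; injective = λ {(_ , g)} {(_ , h)} → Equivalence.from (image-injective g h)
          }
        ; surjective = λ h → let (z , gz) , p = preimage (generated h) in
            (z , gz) , λ {(_ , gt)} t≈z → H.trans (Equivalence.to (image-injective gt gz) t≈z) p
        }

module _ (G : Group a ℓ) (H : Group b ℓ′) where
  private
    module G = Group G
    module H = Group H

  -- The value of a word in the subgroup is compared with `H` through `f` and with `G` through
  -- `proj₁`. Allowing any `x′`, `y′` equal to the images lets them be taken from a finite list.
  trivial-word⇔ : ∀ {x y} (f : Group.Carrier ⟨ G ∣ x , y ⟩ → H.Carrier) →
    GroupMorphisms.IsGroupMonomorphism (Group.rawGroup ⟨ G ∣ x , y ⟩) (Group.rawGroup H) f →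
    ∀ {x′ y′} → f (x , gen (inj₁ ≡.refl)) H.≈ x′ → f (y , gen (inj₂ ≡.refl)) H.≈ y′ →
    ∀ w → Words.⟦_⟧ H x′ y′ w H.≈ H.ε ⇔ Words.⟦_⟧ G x y w G.≈ G.ε
  trivial-word⇔ {x} {y} f f-mono {x′} {y′} fx≈ fy≈ w = mk⇔
    (λ w≈ε → G.trans (G.sym proj₁w≈) (injective (H.trans fw≈ (H.trans w≈ε (H.sym ε-homo)))))
    (λ w≈ε → H.trans (H.sym fw≈) (H.trans (⟦⟧-cong (G.trans proj₁w≈ w≈ε)) ε-homo))
    where
    open GroupMorphisms.IsGroupMonomorphism f-mono
    Γ = ⟨ G ∣ x , y ⟩

    fw≈ : f (Words.⟦_⟧ Γ _ _ w) H.≈ Words.⟦_⟧ H x′ y′ w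
    fw≈ = evaluate-homo Γ H f ε-homo ∙-homo fx≈ fy≈ w

    proj₁w≈ : proj₁ (Words.⟦_⟧ Γ (x , gen (inj₁ ≡.refl)) (y , gen (inj₂ ≡.refl)) w) G.≈ Words.⟦_⟧ G x y w
    proj₁w≈ = evaluate-homo Γ G proj₁ G.refl (λ _ _ → G.refl) G.refl G.refl w

-- A₅ as a group generated by two five-cycles

A₅ : Group _ _
A₅ = Alternating 5

module A₅ = Group A₅

_≟_ : (π τ : A₅.Carrier) → Dec (π A₅.≈ τ)
(π , _) ≟ (τ , _) = Fin.all? λ i → π ⟨$⟩ʳ i Fin.≟ τ ⟨$⟩ʳ i

-- The cycle (0 i j k l).
fiveCycle : (i j k l : Fin 5) → 0F ≢ i → 0F ≢ j → 0F ≢ k → 0F ≢ l → A₅.Carrier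
fiveCycle i j k l i≢ j≢ k≢ l≢ = eval ts , ts , i≢ ∷ j≢ ∷ k≢ ∷ l≢ ∷ [] , divides-refl 2 , λ _ → ≡.refl
  where ts = (0F , i) ∷ (0F , j) ∷ (0F , k) ∷ (0F , l) ∷ []

-- Chosen so that `r ∙ s` is the involution (0 2)(1 4), just as RS has order 2.
r s : A₅.Carrier
r = fiveCycle 1F 2F 3F 4F (λ ()) (λ ()) (λ ()) (λ ())
s = fiveCycle 1F 2F 4F 3F (λ ()) (λ ()) (λ ()) (λ ())

module ⟨r,s⟩ = Words A₅ r s

-- The results of searches are abstract, lest conversion checking repeat them.
abstract
  transpositionPair : ∀ i j k l → i ≢ j → k ≢ l →
    Any (λ u → ∀ m → eval {5} ((i , j) ∷ (k , l) ∷ []) ⟨$⟩ʳ m ≡ proj₁ ⟨r,s⟩.⟦ u ⟧ ⟨$⟩ʳ m) words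
  transpositionPair = toWitness {a? = Fin.all? λ i → Fin.all? λ j → Fin.all? λ k → Fin.all? λ l →
    ¬? (i Fin.≟ j) →-dec ¬? (k Fin.≟ l) →-dec
    Any.any? (λ u → Fin.all? λ m → eval ((i , j) ∷ (k , l) ∷ []) ⟨$⟩ʳ m Fin.≟ proj₁ ⟨r,s⟩.⟦ u ⟧ ⟨$⟩ʳ m) words} _

-- An even product falls into consecutive pairs of transpositions, each of them a word by
-- `transpositionPair`. Equality in `A₅` ignores the evidence of evenness, so any decomposition
-- serves.
evenProduct-generated : (ts : TranspositionList 5) (ps : All (λ (i , j) → i ≢ j) ts)
  (even : 2 ∣ length ts) →
  Generated A₅ ⟨r,s⟩.Generators (eval ts , ts , ps , even , λ _ → ≡.refl)
evenProduct-generated [] [] even = respects (λ _ → ≡.refl) unit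
evenProduct-generated (_ ∷ []) ps even = contradiction (∣1⇒≡1 even) λ ()
evenProduct-generated ((i , j) ∷ (k , l) ∷ ts) (i≢j ∷ k≢l ∷ ps) even =
  let u , _ , ijkl≈u = find (transpositionPair i j k l i≢j k≢l) in
  respects (λ m → ≡.cong (eval ts ⟨$⟩ʳ_) (≡.sym (ijkl≈u m)))
    (mult (⟨r,s⟩.generated u)
      (evenProduct-generated ts ps (∣m+n∣m⇒∣n even (divides-refl 1))))

A₅-generated : ∀ π → Generated A₅ ⟨r,s⟩.Generators π
A₅-generated (π , ts , ps , even , ts≈π) = respects ts≈π (evenProduct-generated ts ps even)

-- Words that are trivial, respectively nontrivial, in ⟨R,S⟩ when ωλ = ωκ.
relators nonrelators : List Word
relators    = (ρ ∷ []) ^ᵂ 5 ∷ (σ ∷ []) ^ᵂ 5 ∷ (ρ ∷ σ ∷ []) ^ᵂ 2 ∷ []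
nonrelators = (ρ ∷ σ ∷ []) ∷ (ρ ∷ (σ ∷ []) ^ᵂ 4) ^ᵂ 3 ∷ []

Trivial : A₅.Carrier → A₅.Carrier → Word → Set
Trivial π τ w = Words.⟦_⟧ A₅ π τ w A₅.≈ A₅.ε

trivial? : ∀ π τ w → Dec (Trivial π τ w)
trivial? π τ w = Words.⟦_⟧ A₅ π τ w ≟ A₅.ε

-- The matrices R and S have determinant 1 and traces ωκ and ωλ, whence the name. The fourth power
-- of `σ` in `nonrelators` plays the part of S⁻¹.
EqualTraces : A₅.Carrier → A₅.Carrier → Set
EqualTraces π τ = All (Trivial π τ) relators × All (¬_ ∘ Trivial π τ) nonrelators

equalTraces? : ∀ π τ → Dec (EqualTraces π τ)
equalTraces? π τ = All.all? (trivial? π τ) relators ×-dec All.all? (¬? ∘ trivial? π τ) nonrelators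

abstract
  -- Settled by inspecting all pairs of the 60 words. The nonrelator ρσ rules out the pairs x, x⁻¹
  -- with x of order 5, which meet all the other conditions.
  noEqualTraces : All (λ u → All (λ v → ¬ EqualTraces ⟨r,s⟩.⟦ u ⟧ ⟨r,s⟩.⟦ v ⟧) words) words
  noEqualTraces = toWitness {a? = All.all? (λ u → All.all? (λ v → ¬? (equalTraces? ⟨r,s⟩.⟦ u ⟧ ⟨r,s⟩.⟦ v ⟧)) words) words} _

-- Quadratic extensions, matrices over them, and their images in a field

-- The ring A[θ]/(θ² − pθ − q); the pair (a , b) stands for a + bθ.
quadratic : (A : RawRing a ℓ) → (p q : RawRing.Carrier A) → RawRing a ℓ
quadratic A p q = record
  { Carrier = Carrier × Carrier
  ; _≈_     = λ (a , b) (c , d) → a ≈ c × b ≈ d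
  ; _+_     = λ (a , b) (c , d) → a + c , b + d
  ; _*_     = λ (a , b) (c , d) → a * c + q * (b * d) , a * d + b * c + p * (b * d)
  ; -_      = λ (a , b) → - a , - b
  ; 0#      = 0# , 0#
  ; 1#      = 1# , 0#
  }
  where open RawRing A

-- The product of a + bθ with its conjugate a + b(p - θ).
norm : (A : RawRing a ℓ) → (p q : RawRing.Carrier A) → RawRing.Carrier (quadratic A p q) → RawRing.Carrier A
norm A p q (a , b) = a * a + p * (a * b) + - (q * (b * b))
  where open RawRing A

module Matrices (A : RawRing a ℓ) where
  open RawRing A

  -- Entries lie in a raw ring, as products are only computed. Without eta, a product with a neutral
  -- factor stays folded.
  record Square : Set a where
    no-eta-equality
    pattern
    constructor square
    field
      e₁₁ e₁₂ e₂₁ e₂₂ : Carrier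

  infixl 7 _⊠_

  _⊠_ : Square → Square → Square
  square a b c d ⊠ square a′ b′ c′ d′ =
    square (a * a′ + b * c′) (a * b′ + b * d′)
           (c * a′ + d * c′) (c * b′ + d * d′)

  𝟙 : Square
  𝟙 = square 1# 0# 0# 1#

  adj : Square → Square
  adj (square a b c d) = square d (- b) (- c) a

  Scalar : Pred Square a
  Scalar (square a b c d) = a ≡ d × b ≡ 0# × c ≡ 0#

module FieldProperties (K : DiscreteField c ℓ₁ ℓ₂) where
  open DiscreteField K hiding (_^_)
  open IntegerRingSolver commutativeRing
  open SetoidReasoning setoid

  -- The canonical map ℤ → K, recovered from the constants of the ring solver.
  integers : ℤ.+-*-rawRing -Raw-AlmostCommutative⟶ fromCommutativeRing commutativeRing
  integers = record
    { ⟦_⟧    = λ i → ⟦ con i ⟧N []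
    ; +-homo = λ i j → +N-homo (con i) (con j) []
    ; *-homo = λ i j → *N-homo (con i) (con j) []
    ; -‿homo = λ i → -N‿-homo (con i) []
    ; 0-homo = refl
    ; 1-homo = refl
    }

  xy≈0⇒y≈0 : ∀ {x y} → x * y ≈ 0# → ¬ x ≈ 0# → y ≈ 0#
  xy≈0⇒y≈0 {x} {y} xy≈0 x≉0 = begin
    y                ≈⟨ *-identityˡ y ⟨
    1# * y           ≈⟨ *-congʳ (⁻¹-inverseʳ (≉⇒# x≉0)) ⟨
    x * x ⁻¹ * y     ≈⟨ solve 3 (λ x x′ y → x :* x′ :* y := x′ :* (x :* y)) refl x (x ⁻¹) y ⟩
    x ⁻¹ * (x * y)   ≈⟨ *-congˡ xy≈0 ⟩
    x ⁻¹ * 0#        ≈⟨ zeroʳ _ ⟩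
    0#               ∎

  1≉0 : ¬ 1# ≈ 0#
  1≉0 1≈0 = #-irrefl 1≈0 1#0

  module _ {A : RawRing a ℓ} (φ : A -Raw-AlmostCommutative⟶ fromCommutativeRing commutativeRing) where
    private
      module A = RawRing A
      module φ = _-Raw-AlmostCommutative⟶_ φ

    homo-+ : ∀ {x y u v} → φ.⟦ x ⟧ ≈ u → φ.⟦ y ⟧ ≈ v → φ.⟦ x A.+ y ⟧ ≈ u + v
    homo-+ x≈u y≈v = trans (φ.+-homo _ _) (+-cong x≈u y≈v)

    homo-* : ∀ {x y u v} → φ.⟦ x ⟧ ≈ u → φ.⟦ y ⟧ ≈ v → φ.⟦ x A.* y ⟧ ≈ u * v
    homo-* x≈u y≈v = trans (φ.*-homo _ _) (*-cong x≈u y≈v)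

    homo-neg : ∀ {x u} → φ.⟦ x ⟧ ≈ u → φ.⟦ A.- x ⟧ ≈ - u
    homo-neg x≈u = trans (φ.-‿homo _) (-‿cong x≈u)

    module _ (p q : A.Carrier) (θ : Carrier) (θ²≈pθ+q : θ * θ ≈ φ.⟦ p ⟧ * θ + φ.⟦ q ⟧) where

      adjoin : quadratic A p q -Raw-AlmostCommutative⟶ fromCommutativeRing commutativeRing
      adjoin = record
        { ⟦_⟧    = value
        ; +-homo = λ (a , b) (c , d) → trans
            (+-cong (φ.+-homo a c) (*-congʳ (φ.+-homo b d)))
            (solve 5 (λ a b c d t → a :+ c :+ (b :+ d) :* t := a :+ b :* t :+ (c :+ d :* t)) refl
              φ.⟦ a ⟧ φ.⟦ b ⟧ φ.⟦ c ⟧ φ.⟦ d ⟧ θ)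
        ; *-homo = λ (a , b) (c , d) → begin
            φ.⟦ a A.* c A.+ q A.* (b A.* d) ⟧ + φ.⟦ a A.* d A.+ b A.* c A.+ p A.* (b A.* d) ⟧ * θ
              ≈⟨ +-cong (homo-+ (φ.*-homo a c) (homo-* refl (φ.*-homo b d)))
                   (*-congʳ (homo-+ (homo-+ (φ.*-homo a d) (φ.*-homo b c)) (homo-* refl (φ.*-homo b d)))) ⟩
            φ.⟦ a ⟧ * φ.⟦ c ⟧ + φ.⟦ q ⟧ * (φ.⟦ b ⟧ * φ.⟦ d ⟧)
              + (φ.⟦ a ⟧ * φ.⟦ d ⟧ + φ.⟦ b ⟧ * φ.⟦ c ⟧ + φ.⟦ p ⟧ * (φ.⟦ b ⟧ * φ.⟦ d ⟧)) * θ
              -- Isolates pθ + q, which the hypothesis on θ then exchanges for θ².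
              ≈⟨ solve 7 (λ a b c d p q t →
                   a :* c :+ q :* (b :* d) :+ (a :* d :+ b :* c :+ p :* (b :* d)) :* t
                     := a :* c :+ (a :* d :+ b :* c) :* t :+ b :* d :* (p :* t :+ q)) refl
                   φ.⟦ a ⟧ φ.⟦ b ⟧ φ.⟦ c ⟧ φ.⟦ d ⟧ φ.⟦ p ⟧ φ.⟦ q ⟧ θ ⟩
            φ.⟦ a ⟧ * φ.⟦ c ⟧ + (φ.⟦ a ⟧ * φ.⟦ d ⟧ + φ.⟦ b ⟧ * φ.⟦ c ⟧) * θ
              + φ.⟦ b ⟧ * φ.⟦ d ⟧ * (φ.⟦ p ⟧ * θ + φ.⟦ q ⟧)
              ≈⟨ +-congˡ (*-congˡ θ²≈pθ+q) ⟨
            φ.⟦ a ⟧ * φ.⟦ c ⟧ + (φ.⟦ a ⟧ * φ.⟦ d ⟧ + φ.⟦ b ⟧ * φ.⟦ c ⟧) * θ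
              + φ.⟦ b ⟧ * φ.⟦ d ⟧ * (θ * θ)
              ≈⟨ solve 5 (λ a b c d t →
                   a :* c :+ (a :* d :+ b :* c) :* t :+ b :* d :* (t :* t)
                     := (a :+ b :* t) :* (c :+ d :* t)) refl
                   φ.⟦ a ⟧ φ.⟦ b ⟧ φ.⟦ c ⟧ φ.⟦ d ⟧ θ ⟩
            value (a , b) * value (c , d) ∎
        ; -‿homo = λ (a , b) → trans
            (+-cong (φ.-‿homo a) (*-congʳ (φ.-‿homo b)))
            (solve 3 (λ a b t → :- a :+ :- b :* t := :- (a :+ b :* t)) refl φ.⟦ a ⟧ φ.⟦ b ⟧ θ)
        ; 0-homo = trans (+-cong φ.0-homo (*-congʳ φ.0-homo)) (trans (+-identityˡ _) (zeroˡ θ))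
        ; 1-homo = trans (+-cong φ.1-homo (trans (*-congʳ φ.0-homo) (zeroˡ θ))) (+-identityʳ 1#)
        }
        where
        value : A.Carrier × A.Carrier → Carrier
        value (a , b) = φ.⟦ a ⟧ + φ.⟦ b ⟧ * θ

      -- A zero a + bθ annihilates its conjugate a + bp − bθ as well.
      norm-zero : ∀ {x} → _-Raw-AlmostCommutative⟶_.⟦_⟧ adjoin x ≈ 0# → φ.⟦ norm A p q x ⟧ ≈ 0#
      norm-zero {a , b} a+bθ≈0 = begin
        φ.⟦ a A.* a A.+ p A.* (a A.* b) A.+ A.- (q A.* (b A.* b)) ⟧
          ≈⟨ homo-+ (homo-+ (φ.*-homo a a) (homo-* refl (φ.*-homo a b)))
                (homo-neg (homo-* refl (φ.*-homo b b))) ⟩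
        u * u + p′ * (u * v) - q′ * (v * v)
          ≈⟨ solve 5 (λ u v p q t → u :* u :+ p :* (u :* v) :- q :* (v :* v)
               := (u :+ v :* t) :* (u :+ v :* p :- v :* t) :+ v :* v :* (t :* t :- (p :* t :+ q))) refl
               u v p′ q′ θ ⟩
        (u + v * θ) * (u + v * p′ - v * θ) + v * v * (θ * θ - (p′ * θ + q′))
          ≈⟨ +-cong (*-congʳ a+bθ≈0) (*-congˡ (+-congʳ θ²≈pθ+q)) ⟩
        0# * (u + v * p′ - v * θ) + v * v * ((p′ * θ + q′) - (p′ * θ + q′))
          ≈⟨ solve 3 (λ x y z → con (+ 0) :* x :+ y :* (z :- z) := con (+ 0)) refl _ _ _ ⟩
        0# ∎
        where
        u = φ.⟦ a ⟧
        v = φ.⟦ b ⟧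
        p′ = φ.⟦ p ⟧
        q′ = φ.⟦ q ⟧

    open Matrices A
    private module PGL = Group (PGL₂ K)

    infix 4 _◃_

    -- M represents X up to scalars.  Stated for matrices rather than elements
    -- of GL₂, whose proofs of invertibility are costly to compare.
    record _◃_ (X : Mat₂ K) (M : Square) : Set (c ⊔ ℓ₁ ⊔ ℓ₂) where
      constructor scaled
      open Square M
      field
        k    : Carrier
        k#0  : k # 0#
        X≈kM : _≈ᴹ_ K X (_•_ K k (mat φ.⟦ e₁₁ ⟧ φ.⟦ e₁₂ ⟧ φ.⟦ e₂₁ ⟧ φ.⟦ e₂₂ ⟧))

    ◃-* : ∀ {X Y M N} → X ◃ M → Y ◃ N → _*ᴹ_ K X Y ◃ M ⊠ N
    ◃-* {M = square _ _ _ _} {square _ _ _ _} (scaled k k#0 (mat≈ p₁₁ p₁₂ p₂₁ p₂₂)) (scaled l l#0 (mat≈ q₁₁ q₁₂ q₂₁ q₂₂)) =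
      scaled (k * l) (x#0y#0→xy#0 k#0 l#0)
        (mat≈ (f p₁₁ q₁₁ p₁₂ q₂₁) (f p₁₁ q₁₂ p₁₂ q₂₂) (f p₂₁ q₁₁ p₂₂ q₂₁) (f p₂₁ q₁₂ p₂₂ q₂₂))
      where
      f : ∀ {x y z w a b c d} → x ≈ k * φ.⟦ a ⟧ → y ≈ l * φ.⟦ b ⟧ → z ≈ k * φ.⟦ c ⟧ → w ≈ l * φ.⟦ d ⟧ →
          x * y + z * w ≈ k * l * φ.⟦ a A.* b A.+ c A.* d ⟧
      f {x} {y} {z} {w} {a} {b} {c} {d} x≈ y≈ z≈ w≈ = begin
        x * y + z * w
          ≈⟨ +-cong (*-cong x≈ y≈) (*-cong z≈ w≈) ⟩
        k * φ.⟦ a ⟧ * (l * φ.⟦ b ⟧) + k * φ.⟦ c ⟧ * (l * φ.⟦ d ⟧)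
          ≈⟨ solve 6 (λ k l a b c d → k :* a :* (l :* b) :+ k :* c :* (l :* d) := k :* l :* (a :* b :+ c :* d)) refl
               k l φ.⟦ a ⟧ φ.⟦ b ⟧ φ.⟦ c ⟧ φ.⟦ d ⟧ ⟩
        k * l * (φ.⟦ a ⟧ * φ.⟦ b ⟧ + φ.⟦ c ⟧ * φ.⟦ d ⟧)
          ≈⟨ *-congˡ (homo-+ (φ.*-homo a b) (φ.*-homo c d)) ⟨
        k * l * φ.⟦ a A.* b A.+ c A.* d ⟧ ∎

    ◃-adj : ∀ {X M} → X ◃ M → adjugate K X ◃ adj M
    ◃-adj {M = square _ _ _ _} (scaled k k#0 (mat≈ p₁₁ p₁₂ p₂₁ p₂₂)) = scaled k k#0 (mat≈ p₂₂ (f p₁₂) (f p₂₁) p₁₁)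
      where
      f : ∀ {x a} → x ≈ k * φ.⟦ a ⟧ → - x ≈ k * φ.⟦ A.- a ⟧
      f {x} {a} x≈ = begin
        - x                   ≈⟨ -‿cong x≈ ⟩
        - (k * φ.⟦ a ⟧)       ≈⟨ solve 2 (λ k a → :- (k :* a) := k :* (:- a)) refl k φ.⟦ a ⟧ ⟩
        k * - φ.⟦ a ⟧         ≈⟨ *-congˡ (φ.-‿homo a) ⟨
        k * φ.⟦ A.- a ⟧       ∎

    -- `Scalar` admits the zero matrix; that the diagonal entry is nonzero in K comes from the
    -- determinant of `x`.
    ◃-scalar : ∀ {x M} → GL₂.matrix x ◃ M → Scalar M → x PGL.≈ PGL.ε
    ◃-scalar {x} {square a _ _ _} (scaled k k#0 (mat≈ p₁₁ p₁₂ p₂₁ p₂₂)) (≡.refl , ≡.refl , ≡.refl) =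
      z , ≉⇒# z≉0 , mat≈ (one p₁₁) (zero′ p₁₂) (zero′ p₂₁) (one p₂₂)
      where
      z = k * φ.⟦ a ⟧

      one : ∀ {y} → y ≈ z → y ≈ z * 1#
      one y≈z = trans y≈z (sym (*-identityʳ z))

      zero′ : ∀ {y} → y ≈ k * φ.⟦ A.0# ⟧ → y ≈ z * 0#
      zero′ y≈k0 = trans y≈k0 (trans (*-congˡ φ.0-homo) (trans (zeroʳ k) (sym (zeroʳ z))))

      z≉0 : ¬ z ≈ 0#
      z≉0 z≈0 = #-irrefl (begin
        det K (GL₂.matrix x)        ≈⟨ +-cong (*-cong p₁₁ p₂₂) (-‿cong (*-cong (zero′ p₁₂) (zero′ p₂₁))) ⟩
        z * z - z * 0# * (z * 0#)   ≈⟨ solve 1 (λ z → z :* z :- z :* con (+ 0) :* (z :* con (+ 0)) := z :* z) refl z ⟩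
        z * z                       ≈⟨ *-congˡ z≈0 ⟩
        z * 0#                      ≈⟨ zeroʳ z ⟩
        0#                          ∎) (GL₂.det#0 x)

    -- If `x` were scalar, k c and k (a - d) would vanish, and k is invertible.
    ◃-nonscalar : ∀ {x M} → GL₂.matrix x ◃ M →
                  ¬ φ.⟦ Square.e₂₁ M ⟧ ≈ 0# ⊎ ¬ φ.⟦ Square.e₁₁ M A.+ A.- Square.e₂₂ M ⟧ ≈ 0# →
                  ¬ x PGL.≈ PGL.ε
    ◃-nonscalar {x} {square a b c d} (scaled k k#0 (mat≈ p₁₁ _ p₂₁ p₂₂)) nonscalar (m , _ , mat≈ q₁₁ _ q₂₁ q₂₂) =
      [ (λ c≉0 → c≉0 (xy≈0⇒y≈0 kc≈0 k≉0)) , (λ a-d≉0 → a-d≉0 (xy≈0⇒y≈0 k[a-d]≈0 k≉0)) ]′ nonscalar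
      where
      k≉0 : ¬ k ≈ 0#
      k≉0 k≈0 = #-irrefl k≈0 k#0

      kc≈0 : k * φ.⟦ c ⟧ ≈ 0#
      kc≈0 = trans (sym p₂₁) (trans q₂₁ (zeroʳ m))

      k[a-d]≈0 : k * φ.⟦ a A.+ A.- d ⟧ ≈ 0#
      k[a-d]≈0 = begin
        k * φ.⟦ a A.+ A.- d ⟧            ≈⟨ *-congˡ (homo-+ refl (φ.-‿homo d)) ⟩
        k * (φ.⟦ a ⟧ - φ.⟦ d ⟧)          ≈⟨ solve 3 (λ k a d → k :* (a :- d) := k :* a :- k :* d) refl k φ.⟦ a ⟧ φ.⟦ d ⟧ ⟩
        k * φ.⟦ a ⟧ - k * φ.⟦ d ⟧        ≈⟨ +-cong (trans (sym p₁₁) q₁₁) (-‿cong (trans (sym p₂₂) q₂₂)) ⟩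
        m * 1# - m * 1#                  ≈⟨ -‿inverseʳ _ ⟩
        0#                               ∎

-- Decidable computations over ℤ[ω, ξ]

ℤ[ω] : RawRing 0ℓ 0ℓ
ℤ[ω] = quadratic ℤ.+-*-rawRing (+ 1) (+ 1)

ω₀ -1₀ : RawRing.Carrier ℤ[ω]
ω₀  = + 0 , + 1
-1₀ = -[1+ 0 ] , + 0

ℤ[ω,ξ] : RawRing 0ℓ 0ℓ
ℤ[ω,ξ] = quadratic ℤ[ω] ω₀ -1₀

module E = RawRing ℤ[ω,ξ]

normᴱ : E.Carrier → ℤ
normᴱ x = norm ℤ.+-*-rawRing (+ 1) (+ 1) (norm ℤ[ω] ω₀ -1₀ x)

_≟ᴱ_ : DecidableEquality E.Carrier
_≟ᴱ_ = Product.≡-dec (Product.≡-dec ℤ._≟_ ℤ._≟_) (Product.≡-dec ℤ._≟_ ℤ._≟_)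

open Matrices ℤ[ω,ξ]

scalar? : ∀ M → Dec (Scalar M)
scalar? (square a b c d) = a ≟ᴱ d ×-dec b ≟ᴱ E.0# ×-dec c ≟ᴱ E.0#

-- The exponent accommodates the norm 5¹³ of an entry of (RS⁻¹)³.
Nonvanishing : Pred E.Carrier 0ℓ
Nonvanishing x = normᴱ x ℤ.∣ + (10 ^ 13)

nonvanishing? : ∀ x → Dec (Nonvanishing x)
nonvanishing? x = normᴱ x ℤ.∣? + (10 ^ 13)

Nonscalar : Pred Square 0ℓ
Nonscalar (square a b c d) = Nonvanishing c ⊎ Nonvanishing (a E.+ E.- d)

nonscalar? : ∀ M → Dec (Nonscalar M)
nonscalar? (square a b c d) = nonvanishing? c ⊎-dec nonvanishing? (a E.+ E.- d)

-- ω̄ᴱ = 1 − ω, and ξ⁻¹ = ω − ξ.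
ωᴱ ω̄ᴱ 4ᴱ ξᴱ ξ⁻¹ᴱ : E.Carrier
ωᴱ   = ω₀ , (+ 0 , + 0)
ω̄ᴱ   = (+ 1 , -[1+ 0 ]) , (+ 0 , + 0)
4ᴱ   = (+ 4 , + 0) , (+ 0 , + 0)
ξᴱ   = (+ 0 , + 0) , (+ 1 , + 0)
ξ⁻¹ᴱ = ω₀ , -1₀

Rᴱ : Square
Rᴱ = square ξᴱ E.0# E.0# ξ⁻¹ᴱ

-- The scalar η is omitted.
Sᴱ : E.Carrier → Square
Sᴱ ωλ = square (E.- ωλ E.* ξ⁻¹ᴱ) (E.- (ωᴱ E.* ωᴱ E.+ ωλ E.* ωλ E.+ E.- 4ᴱ))
               E.1#              (ωλ E.* ξᴱ)

shadow : E.Carrier → Word → Square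
shadow ωλ = evaluate _⊠_ 𝟙 Rᴱ (Sᴱ ωλ)

-- One `v` has to serve in both groups at once. For matrices, equality up to scalars is tested by
-- multiplying with `adj`, the inverse up to the determinant.
Step : Letter → Word → Word → Set
Step l u v = ⟨r,s⟩.⟦ u ⟧ A₅.∙ ⟨r,s⟩.⟦ l ⟧ˡ A₅.≈ ⟨r,s⟩.⟦ v ⟧
  × Scalar (shadow ω̄ᴱ u ⊠ letter Rᴱ (Sᴱ ω̄ᴱ) l ⊠ adj (shadow ω̄ᴱ v))

step? : ∀ l u v → Dec (Step l u v)
step? l u v = ((⟨r,s⟩.⟦ u ⟧ A₅.∙ ⟨r,s⟩.⟦ l ⟧ˡ) ≟ ⟨r,s⟩.⟦ v ⟧)
  ×-dec scalar? (shadow ω̄ᴱ u ⊠ letter Rᴱ (Sᴱ ω̄ᴱ) l ⊠ adj (shadow ω̄ᴱ v))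

Inverse : Word → Word → Set
Inverse u v = ⟨r,s⟩.⟦ u ⟧ A₅.∙ ⟨r,s⟩.⟦ v ⟧ A₅.≈ A₅.ε × Scalar (shadow ω̄ᴱ u ⊠ shadow ω̄ᴱ v)

inverse? : ∀ u v → Dec (Inverse u v)
inverse? u v = ((⟨r,s⟩.⟦ u ⟧ A₅.∙ ⟨r,s⟩.⟦ v ⟧) ≟ A₅.ε) ×-dec scalar? (shadow ω̄ᴱ u ⊠ shadow ω̄ᴱ v)

Faithful : Word → Set
Faithful u = (⟨r,s⟩.⟦ u ⟧ A₅.≈ A₅.ε × Scalar (shadow ω̄ᴱ u)) ⊎ (¬ ⟨r,s⟩.⟦ u ⟧ A₅.≈ A₅.ε × Nonscalar (shadow ω̄ᴱ u))

faithful? : ∀ u → Dec (Faithful u)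
faithful? u = (⟨r,s⟩.⟦ u ⟧ ≟ A₅.ε ×-dec scalar? (shadow ω̄ᴱ u)) ⊎-dec (¬? (⟨r,s⟩.⟦ u ⟧ ≟ A₅.ε) ×-dec nonscalar? (shadow ω̄ᴱ u))

abstract
  stepped : ∀ l → All (λ u → Any (Step l u) words) words
  stepped ρ = toWitness {a? = All.all? (λ u → Any.any? (step? ρ u) words) words} _
  stepped σ = toWitness {a? = All.all? (λ u → Any.any? (step? σ u) words) words} _

  inverted : All (λ u → Any (Inverse u) words) words
  inverted = toWitness {a? = All.all? (λ u → Any.any? (inverse? u) words) words} _

  faithful : All Faithful words
  faithful = toWitness {a? = All.all? faithful? words} _

  relators-scalar : All (Scalar ∘ shadow ωᴱ) relators
  relators-scalar = toWitness {a? = All.all? (scalar? ∘ shadow ωᴱ) relators} _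

  nonrelators-nonscalar : All (Nonscalar ∘ shadow ωᴱ) nonrelators
  nonrelators-nonscalar = toWitness {a? = All.all? (nonscalar? ∘ shadow ωᴱ) nonrelators} _

-- Primitive tenth roots of unity and the map from ℤ[ω, ξ] to K

module PrimitiveTenthRoot (K : DiscreteField c ℓ₁ ℓ₂) {ξ : DiscreteField.Carrier K}
  (ξ-primitive : IsPrimitiveRoot K 10 ξ) where
  open DiscreteField K renaming (_^_ to _^ᴷ_)
  open FieldProperties K
  open IntegerRingSolver commutativeRing
  open IsPrimitiveRoot ξ-primitive
  open SetoidReasoning setoid

  private
    module integers = _-Raw-AlmostCommutative⟶_ integers
    module PGL = Group (PGL₂ K)

  w : Carrier
  w = ω K ξ

  ξξ⁻¹≈1 : ξ * ξ ⁻¹ ≈ 1#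
  ξξ⁻¹≈1 = ⁻¹-inverseʳ (invertibleʳ⇒# (ξ ^ᴷ 9 , trans (*-congʳ (x-0≈x ξ)) root))

  ξ²≉1 : ¬ ξ ^ᴷ 2 ≈ 1#
  ξ²≉1 = minimal 2 (s≤s z≤n) (s≤s (s≤s (s≤s z≤n)))

  ξ⁵≉1 : ¬ ξ ^ᴷ 5 ≈ 1#
  ξ⁵≉1 = minimal 5 (s≤s z≤n) (s≤s (s≤s (s≤s (s≤s (s≤s (s≤s z≤n))))))

  ξ≉-1 : ¬ ξ + 1# ≈ 0#
  ξ≉-1 ξ+1≈0 = ξ²≉1 (begin
    ξ ^ᴷ 2                         ≈⟨ solve 1 (λ x → x :^ 2 := (x :+ con (+ 1)) :* (x :- con (+ 1)) :+ con (+ 1)) refl ξ ⟩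
    (ξ + 1#) * (ξ - 1#) + 1#       ≈⟨ +-congʳ (trans (*-congʳ ξ+1≈0) (zeroˡ _)) ⟩
    0# + 1#                        ≈⟨ +-identityˡ 1# ⟩
    1#                             ∎)

  ξ-ξ⁻¹≉0 : ¬ ξ - ξ ⁻¹ ≈ 0#
  ξ-ξ⁻¹≉0 ξ-ξ⁻¹≈0 = ξ²≉1 (begin
    ξ ^ᴷ 2                        ≈⟨ solve 2 (λ x y → x :^ 2 := x :* (x :- y) :+ x :* y) refl ξ (ξ ⁻¹) ⟩
    ξ * (ξ - ξ ⁻¹) + ξ * ξ ⁻¹     ≈⟨ +-cong (trans (*-congˡ ξ-ξ⁻¹≈0) (zeroʳ ξ)) ξξ⁻¹≈1 ⟩
    0# + 1#                       ≈⟨ +-identityˡ 1# ⟩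
    1#                            ∎)

  ξ⁵+1≈0 : ξ ^ᴷ 5 + 1# ≈ 0#
  ξ⁵+1≈0 = xy≈0⇒y≈0 (begin
    (ξ ^ᴷ 5 - 1#) * (ξ ^ᴷ 5 + 1#)   ≈⟨ solve 1 (λ x → (x :^ 5 :- con (+ 1)) :* (x :^ 5 :+ con (+ 1)) := x :^ 10 :- con (+ 1)) refl ξ ⟩
    ξ ^ᴷ 10 - 1#                    ≈⟨ +-congʳ root ⟩
    1# - 1#                         ≈⟨ -‿inverseʳ 1# ⟩
    0#                              ∎)
    λ ξ⁵-1≈0 → ξ⁵≉1 (begin
      ξ ^ᴷ 5               ≈⟨ solve 1 (λ x → x := x :- con (+ 1) :+ con (+ 1)) refl (ξ ^ᴷ 5) ⟩
      ξ ^ᴷ 5 - 1# + 1#     ≈⟨ +-congʳ ξ⁵-1≈0 ⟩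
      0# + 1#              ≈⟨ +-identityˡ 1# ⟩
      1#                   ∎)

  -- The tenth cyclotomic polynomial, (x⁵ + 1) / (x + 1).
  Φ₁₀ : Carrier → Carrier
  Φ₁₀ x = x ^ᴷ 4 - x ^ᴷ 3 + x ^ᴷ 2 - x + 1#

  Φ₁₀≈0 : Φ₁₀ ξ ≈ 0#
  Φ₁₀≈0 = xy≈0⇒y≈0 (trans (solve 1 (λ x →
      (x :+ con (+ 1)) :* (x :^ 4 :- x :^ 3 :+ x :^ 2 :- x :+ con (+ 1)) := x :^ 5 :+ con (+ 1)) refl ξ)
    ξ⁵+1≈0) ξ≉-1

  -- Given ξξ⁻¹ = 1, w² - w - 1 is `Φ₁₀ ξ` divided by ξ². The solver treats ξ and ξ⁻¹ as
  -- independent, so the identity carries a correction, ξξ⁻¹ - 1 times the cofactor `z`.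
  w²≈w+1 : w * w ≈ w + 1#
  w²≈w+1 = begin
    w * w
      ≈⟨ solve 2 (λ x y → (x :+ y) :* (x :+ y) := x :+ y :+ con (+ 1)
           :+ (y :^ 2 :* (x :^ 4 :- x :^ 3 :+ x :^ 2 :- x :+ con (+ 1))
           :+ (x :* y :- con (+ 1)) :* (y :+ (con (+ 1) :- x :* y) :+ (x :- x :* x) :* (con (+ 1) :+ x :* y))))
           refl ξ (ξ ⁻¹) ⟩
    w + 1# + (ξ ⁻¹ ^ᴷ 2 * Φ₁₀ ξ + (ξ * ξ ⁻¹ - 1#) * z)
      ≈⟨ +-congˡ (+-cong (*-congˡ Φ₁₀≈0) (*-congʳ (+-congʳ ξξ⁻¹≈1))) ⟩
    w + 1# + (ξ ⁻¹ ^ᴷ 2 * 0# + (1# - 1#) * z)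
      ≈⟨ solve 3 (λ w u z → w :+ (u :* con (+ 0) :+ (con (+ 1) :- con (+ 1)) :* z) := w) refl (w + 1#) (ξ ⁻¹ ^ᴷ 2) z ⟩
    w + 1# ∎
    where
    z = ξ ⁻¹ + (1# - ξ * ξ ⁻¹) + (ξ - ξ * ξ) * (1# + ξ * ξ ⁻¹)

  -- In characteristic 2, ξ⁵ = -1 would equal 1.
  2≉0 : ¬ ⟦ con (+ 2) ⟧ [] ≈ 0#
  2≉0 2≈0 = ξ⁵≉1 (begin
    ξ ^ᴷ 5                                    ≈⟨ solve 1 (λ x → x := (x :+ con (+ 1)) :- con (+ 2) :+ con (+ 1)) refl (ξ ^ᴷ 5) ⟩
    (ξ ^ᴷ 5 + 1#) - ⟦ con (+ 2) ⟧ [] + 1#     ≈⟨ +-congʳ (+-cong ξ⁵+1≈0 (-‿cong 2≈0)) ⟩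
    0# - 0# + 1#                              ≈⟨ solve 0 (con (+ 0) :- con (+ 0) :+ con (+ 1) := con (+ 1)) refl ⟩
    1#                                        ∎)

  -- Φ₁₀(x) ≡ (x + 1)⁴ modulo 5.
  5≉0 : ¬ ⟦ con (+ 5) ⟧ [] ≈ 0#
  5≉0 5≈0 = ξ≉-1 (xy≈0⇒y≈0 (xy≈0⇒y≈0 (xy≈0⇒y≈0 (begin
    x * (x * (x * x))
      ≈⟨ solve 1 (λ x → (x :+ con (+ 1)) :* ((x :+ con (+ 1)) :* ((x :+ con (+ 1)) :* (x :+ con (+ 1))))
           := x :^ 4 :- x :^ 3 :+ x :^ 2 :- x :+ con (+ 1) :+ con (+ 5) :* (x :^ 3 :+ x :^ 2 :+ x)) refl ξ ⟩
    Φ₁₀ ξ + ⟦ con (+ 5) ⟧ [] * (ξ ^ᴷ 3 + ξ ^ᴷ 2 + ξ)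
      ≈⟨ +-cong Φ₁₀≈0 (trans (*-congʳ 5≈0) (zeroˡ _)) ⟩
    0# + 0#
      ≈⟨ +-identityˡ 0# ⟩
    0# ∎) ξ≉-1) ξ≉-1) ξ≉-1)
    where
    x = ξ + 1#

  10^k≉0 : ∀ k → ¬ ⟦ con (+ (10 ^ k)) ⟧ [] ≈ 0#
  10^k≉0 zero 1≈0 = 1≉0 1≈0
  10^k≉0 (suc k) 10^1+k≈0 = 10^k≉0 k (xy≈0⇒y≈0 (trans (sym (integers.*-homo (+ 10) (+ (10 ^ k))))
    (trans (reflexive (≡.cong integers.⟦_⟧ (≡.sym (ℤ.pos-* 10 (10 ^ k))))) 10^1+k≈0))
    λ 10≈0 → 5≉0 (xy≈0⇒y≈0 (trans (sym (integers.*-homo (+ 2) (+ 5))) 10≈0) 2≉0))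

  w²≈1w+1 : w * w ≈ integers.⟦ + 1 ⟧ * w + integers.⟦ + 1 ⟧
  w²≈1w+1 = trans w²≈w+1 (+-congʳ (sym (*-identityˡ w)))

  ℤ[ω]⟶K : ℤ[ω] -Raw-AlmostCommutative⟶ fromCommutativeRing commutativeRing
  ℤ[ω]⟶K = adjoin integers (+ 1) (+ 1) w w²≈1w+1

  module φ₀ = _-Raw-AlmostCommutative⟶_ ℤ[ω]⟶K

  ξ²≈wξ-1 : ξ * ξ ≈ φ₀.⟦ ω₀ ⟧ * ξ + φ₀.⟦ -1₀ ⟧
  ξ²≈wξ-1 = begin
    ξ * ξ
      ≈⟨ solve 2 (λ x y → x :* x := (x :+ y) :* x :- x :* y) refl ξ (ξ ⁻¹) ⟩
    w * ξ - ξ * ξ ⁻¹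
      ≈⟨ +-congˡ (-‿cong ξξ⁻¹≈1) ⟩
    w * ξ - 1#
      ≈⟨ solve 2 (λ w x → w :* x :- con (+ 1) := (con (+ 0) :+ con (+ 1) :* w) :* x :+ (con -[1+ 0 ] :+ con (+ 0) :* w)) refl w ξ ⟩
    (0# + 1# * w) * ξ + (- 1# + 0# * w) ∎

  -- Abstract, so that equations φ.⟦ a ⟧ ≈ x determine a.
  abstract
    ℤ[ω,ξ]⟶K : ℤ[ω,ξ] -Raw-AlmostCommutative⟶ fromCommutativeRing commutativeRing
    ℤ[ω,ξ]⟶K = adjoin ℤ[ω]⟶K ω₀ -1₀ ξ ξ²≈wξ-1

  module φ = _-Raw-AlmostCommutative⟶_ ℤ[ω,ξ]⟶K

  abstract
    -- If x maps to 0, so does its norm to ℤ[ω], hence its norm to ℤ and every multiple of that; but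
    -- 10¹³ does not, as 2 and 5 are nonzero in K.
    nonvanishing : ∀ x → Nonvanishing x → ¬ φ.⟦ x ⟧ ≈ 0#
    nonvanishing x (ℤ.divides n 10¹³≡n*N) x≈0 = 10^k≉0 13 (begin
      integers.⟦ + (10 ^ 13) ⟧                 ≈⟨ reflexive (≡.cong integers.⟦_⟧ 10¹³≡n*N) ⟩
      integers.⟦ n ℤ.* normᴱ x ⟧                ≈⟨ integers.*-homo n (normᴱ x) ⟩
      integers.⟦ n ⟧ * integers.⟦ normᴱ x ⟧     ≈⟨ *-congˡ (norm-zero integers (+ 1) (+ 1) w w²≈1w+1 {norm ℤ[ω] ω₀ -1₀ x}
                                                      (norm-zero ℤ[ω]⟶K ω₀ -1₀ ξ ξ²≈wξ-1 {x} x≈0)) ⟩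
      integers.⟦ n ⟧ * 0#                       ≈⟨ zeroʳ _ ⟩
      0#                                        ∎)

    -- The map `φ` unfolds only inside `abstract`, so its values at the constants occurring in `Rᴱ`
    -- and `Sᴱ` are worked out here.
    φ-rational : ∀ a → φ.⟦ a , (+ 0 , + 0) ⟧ ≈ φ₀.⟦ a ⟧
    φ-rational a = solve 3 (λ a w x → a :+ (con (+ 0) :+ con (+ 0) :* w) :* x := a) refl φ₀.⟦ a ⟧ w ξ

    φ-ω : φ.⟦ ωᴱ ⟧ ≈ w
    φ-ω = trans (φ-rational ω₀) (solve 1 (λ w → con (+ 0) :+ con (+ 1) :* w := w) refl w)

    φ-ω̄ : φ.⟦ ω̄ᴱ ⟧ ≈ 1# - w
    φ-ω̄ = trans (φ-rational (+ 1 , -[1+ 0 ])) (solve 1 (λ w → con (+ 1) :+ con -[1+ 0 ] :* w := con (+ 1) :- w) refl w)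

    φ-4 : φ.⟦ 4ᴱ ⟧ ≈ 4 · 1#
    φ-4 = trans (φ-rational (+ 4 , + 0)) (solve 1 (λ w → con (+ 4) :+ con (+ 0) :* w
      := con (+ 1) :+ (con (+ 1) :+ (con (+ 1) :+ (con (+ 1) :+ con (+ 0))))) refl w)

    φ-ξ : φ.⟦ ξᴱ ⟧ ≈ ξ
    φ-ξ = solve 2 (λ w x → con (+ 0) :+ con (+ 0) :* w :+ (con (+ 1) :+ con (+ 0) :* w) :* x := x) refl w ξ

    φ-ξ⁻¹ : φ.⟦ ξ⁻¹ᴱ ⟧ ≈ ξ ⁻¹
    φ-ξ⁻¹ = solve 2 (λ x y → con (+ 0) :+ con (+ 1) :* (x :+ y) :+ (con -[1+ 0 ] :+ con (+ 0) :* (x :+ y)) :* x := y) refl ξ (ξ ⁻¹)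

  private
    infix 4 _◃ᴱ_
    _◃ᴱ_ = _◃_ ℤ[ω,ξ]⟶K

  unscaled : ∀ {a x} → φ.⟦ a ⟧ ≈ x → x ≈ 1# * φ.⟦ a ⟧
  unscaled ⟦a⟧≈x = sym (trans (*-identityˡ _) ⟦a⟧≈x)

  -- Serves both cases: `ωλ` will be `ω̄ᴱ` when the two traces differ and `ωᴱ` when they agree.
  module Shadows {ξλ : Carrier} (ωλ : E.Carrier) (φ-ωλ : φ.⟦ ωλ ⟧ ≈ ω K ξλ) where

    R◃Rᴱ : R-matrix K ξ ◃ᴱ Rᴱ
    R◃Rᴱ = scaled 1# 1#0 (mat≈ (unscaled φ-ξ) (unscaled φ.0-homo) (unscaled φ.0-homo) (unscaled φ-ξ⁻¹))

    S◃Sᴱ : S-matrix K ξ ξλ ◃ᴱ Sᴱ ωλ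
    -- The factor η left out of `Sᴱ` reappears as the scalar; it is nonzero because ξ - ξ⁻¹ is.
    S◃Sᴱ = scaled (η K ξ) η#0 (mat≈
      (f (homo-* ℤ[ω,ξ]⟶K (homo-neg ℤ[ω,ξ]⟶K φ-ωλ) φ-ξ⁻¹))
      (f (homo-neg ℤ[ω,ξ]⟶K (trans (homo-+ ℤ[ω,ξ]⟶K
           (homo-+ ℤ[ω,ξ]⟶K (homo-* ℤ[ω,ξ]⟶K φ-ω φ-ω) (homo-* ℤ[ω,ξ]⟶K φ-ωλ φ-ωλ))
           (homo-neg ℤ[ω,ξ]⟶K φ-4))
           (solve 3 (λ u v z → u :* u :+ v :* v :- z := u :^ 2 :+ v :^ 2 :- z) refl w (ω K ξλ) (4 · 1#)))))
      (f φ.1-homo)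
      (f (homo-* ℤ[ω,ξ]⟶K φ-ωλ φ-ξ)))
      where
      f : ∀ {a x} → φ.⟦ a ⟧ ≈ x → η K ξ * x ≈ η K ξ * φ.⟦ a ⟧
      f ⟦a⟧≈x = *-congˡ (sym ⟦a⟧≈x)

      η#0 : η K ξ # 0#
      η#0 = invertibleʳ⇒# (ξ - ξ ⁻¹ , trans (*-comm _ _) (trans (*-congˡ (x-0≈x _)) (⁻¹-inverseʳ (≉⇒# ξ-ξ⁻¹≉0))))

    module ⟨R,S⟩ = Words (PGL₂ K) (R K ξ-primitive) (S K ξ-primitive ξλ)

    letter◃ : ∀ l → GL₂.matrix ⟨R,S⟩.⟦ l ⟧ˡ ◃ᴱ letter Rᴱ (Sᴱ ωλ) l
    letter◃ ρ = R◃Rᴱ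
    letter◃ σ = S◃Sᴱ

    word◃ : ∀ u → GL₂.matrix ⟨R,S⟩.⟦ u ⟧ ◃ᴱ shadow ωλ u
    word◃ [] = scaled 1# 1#0 (mat≈ (unscaled φ.1-homo) (unscaled φ.0-homo) (unscaled φ.0-homo) (unscaled φ.1-homo))
    word◃ (l ∷ u) = ◃-* ℤ[ω,ξ]⟶K (letter◃ l) (word◃ u)

    trivial : ∀ {x M} → GL₂.matrix x ◃ᴱ M → Scalar M → x PGL.≈ PGL.ε
    trivial {x} = ◃-scalar ℤ[ω,ξ]⟶K {x}

    nontrivial : ∀ {x M} → GL₂.matrix x ◃ᴱ M → Nonscalar M → ¬ x PGL.≈ PGL.ε
    nontrivial {x} {square a b c d} x◃M nonscalar =
      ◃-nonscalar ℤ[ω,ξ]⟶K {x} x◃M (Sum.map (nonvanishing c) (nonvanishing (a E.+ E.- d)) nonscalar)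

    -- Inverses in `PGL₂` are adjugates, so the matrix tested represents u l v⁻¹.
    ⟦⟧-step : ∀ l u v → Scalar (shadow ωλ u ⊠ letter Rᴱ (Sᴱ ωλ) l ⊠ adj (shadow ωλ v)) →
           ⟨R,S⟩.⟦ u ⟧ PGL.∙ ⟨R,S⟩.⟦ l ⟧ˡ PGL.≈ ⟨R,S⟩.⟦ v ⟧
    ⟦⟧-step l u v scalar = x∙y⁻¹≈ε⇒x≈y (⟨R,S⟩.⟦ u ⟧ PGL.∙ ⟨R,S⟩.⟦ l ⟧ˡ) ⟨R,S⟩.⟦ v ⟧
      (trivial {⟨R,S⟩.⟦ u ⟧ PGL.∙ ⟨R,S⟩.⟦ l ⟧ˡ PGL.∙ ⟨R,S⟩.⟦ v ⟧ PGL.⁻¹}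
        (◃-* ℤ[ω,ξ]⟶K (◃-* ℤ[ω,ξ]⟶K (word◃ u) (letter◃ l)) (◃-adj ℤ[ω,ξ]⟶K (word◃ v))) scalar)
      where open GroupProperties (PGL₂ K)

    ⟦⟧-inverse : ∀ u v → Scalar (shadow ωλ u ⊠ shadow ωλ v) → ⟨R,S⟩.⟦ u ⟧ PGL.∙ ⟨R,S⟩.⟦ v ⟧ PGL.≈ PGL.ε
    ⟦⟧-inverse u v = trivial {⟨R,S⟩.⟦ u ⟧ PGL.∙ ⟨R,S⟩.⟦ v ⟧} (◃-* ℤ[ω,ξ]⟶K (word◃ u) (word◃ v))

-- Distinguishing A₅ by the values of ωκ and ωλ

A₅-listed : ∀ π → Any (λ u → π A₅.≈ ⟨r,s⟩.⟦ u ⟧) words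
A₅-listed π = listed (A₅-generated π)
  where
  closed : ∀ l → All (λ u → Any (λ v → ⟨r,s⟩.⟦ u ⟧ A₅.∙ ⟨r,s⟩.⟦ l ⟧ˡ A₅.≈ ⟨r,s⟩.⟦ v ⟧) words) words
  closed l = All.map (Any.map proj₁) (stepped l)

  inverse : All (λ u → Any (λ v → ⟨r,s⟩.⟦ u ⟧ A₅.∙ ⟨r,s⟩.⟦ v ⟧ A₅.≈ A₅.ε) words) words
  inverse = All.map (Any.map proj₁) inverted

  open ⟨r,s⟩.Enumeration words (here ≡.refl) closed inverse

module _ (K : DiscreteField c ℓ₁ ℓ₂) {ξκ ξλ : DiscreteField.Carrier K}
  (ξκ-primitive : IsPrimitiveRoot K 10 ξκ) (ξλ-primitive : IsPrimitiveRoot K 10 ξλ) where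
  open DiscreteField K hiding (_^_)
  open FieldProperties K
  open IntegerRingSolver commutativeRing
  open PrimitiveTenthRoot K ξκ-primitive
  open SetoidReasoning setoid

  private module PGL = Group (PGL₂ K)

  -- Subtracting the two quadratic equations gives (ωλ - ωκ)(ωλ + ωκ - 1) = 0.
  ωλ≉ωκ⇒ωλ≈1-ωκ : ¬ ω K ξλ ≈ ω K ξκ → ω K ξλ ≈ 1# - ω K ξκ
  ωλ≉ωκ⇒ωλ≈1-ωκ ωλ≉ωκ = begin
    l                         ≈⟨ solve 2 (λ k l → l := (l :+ k :- con (+ 1)) :+ (con (+ 1) :- k)) refl k l ⟩
    (l + k - 1#) + (1# - k)   ≈⟨ +-congʳ (xy≈0⇒y≈0 product l-k≉0) ⟩
    0# + (1# - k)             ≈⟨ solve 1 (λ x → con (+ 0) :+ x := x) refl (1# - k) ⟩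
    1# - k                    ∎
    where
    k = ω K ξκ
    l = ω K ξλ

    product : (l - k) * (l + k - 1#) ≈ 0#
    product = begin
      (l - k) * (l + k - 1#)
        ≈⟨ solve 2 (λ k l → (l :- k) :* (l :+ k :- con (+ 1)) := l :* l :- l :- (k :* k :- k)) refl k l ⟩
      l * l - l - (k * k - k)
        ≈⟨ +-cong (+-congʳ (PrimitiveTenthRoot.w²≈w+1 K ξλ-primitive)) (-‿cong (+-congʳ w²≈w+1)) ⟩
      l + 1# - l - (k + 1# - k)
        ≈⟨ solve 2 (λ k l → l :+ con (+ 1) :- l :- (k :+ con (+ 1) :- k) := con (+ 0)) refl k l ⟩
      0# ∎

    l-k≉0 : ¬ l - k ≈ 0#
    l-k≉0 l-k≈0 = ωλ≉ωκ (begin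
      l            ≈⟨ solve 2 (λ k l → l := (l :- k) :+ k) refl k l ⟩
      (l - k) + k  ≈⟨ +-congʳ l-k≈0 ⟩
      0# + k       ≈⟨ solve 1 (λ x → con (+ 0) :+ x := x) refl k ⟩
      k            ∎)

  distinct⇒A₅ : ¬ ω K ξλ ≈ ω K ξκ →
    ⟨ PGL₂ K ∣ R K ξκ-primitive , S K ξκ-primitive ξλ ⟩ ≅ A₅
  distinct⇒A₅ ωλ≉ωκ = GraphIsomorphism.isomorphism (PGL₂ K) A₅ (R K ξκ-primitive) (S K ξκ-primitive ξλ) r s
    words (here ≡.refl)
    (λ l → All.map (λ {u} → Any.map (λ {v} (p , q) → ⟦⟧-step l u v q , p)) (stepped l))
    (All.map (λ {u} → Any.map (λ {v} (p , q) → ⟦⟧-inverse u v q , p)) inverted)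
    (All.map (λ {u} → bothTrivial u) faithful)
    A₅-generated
    where
    open Shadows ω̄ᴱ (trans φ-ω̄ (sym (ωλ≉ωκ⇒ωλ≈1-ωκ ωλ≉ωκ)))

    bothTrivial : ∀ u → Faithful u → ⟨R,S⟩.⟦ u ⟧ PGL.≈ PGL.ε ⇔ ⟨r,s⟩.⟦ u ⟧ A₅.≈ A₅.ε
    bothTrivial u (inj₁ (p , q)) = mk⇔ (λ _ → p) (λ _ → trivial {⟨R,S⟩.⟦ u ⟧} (word◃ u) q)
    bothTrivial u (inj₂ (p , q)) = mk⇔
      (λ u≈ε → contradiction u≈ε (nontrivial {⟨R,S⟩.⟦ u ⟧} (word◃ u) q))
      (λ u≈ε → contradiction u≈ε p)

  -- An isomorphism sends R and S to values of two of the 60 words. It preserves the relators and,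
  -- being injective, the nonrelators, contrary to `noEqualTraces`.
  A₅⇒distinct : ⟨ PGL₂ K ∣ R K ξκ-primitive , S K ξκ-primitive ξλ ⟩ ≅ A₅ → ¬ ω K ξλ ≈ ω K ξκ
  A₅⇒distinct (f , f-iso) ωλ≈ωκ =
    let u , u∈words , fR≈u = find (A₅-listed (f (R K ξκ-primitive , gen (inj₁ ≡.refl))))
        v , v∈words , fS≈v = find (A₅-listed (f (S K ξκ-primitive ξλ , gen (inj₂ ≡.refl))))
    in All.lookup (All.lookup noEqualTraces u∈words) v∈words (equalTraces fR≈u fS≈v)
    where
    open Shadows ωᴱ (trans φ-ω (sym ωλ≈ωκ))
    open Equivalence

    equalTraces : ∀ {π τ} → f (R K ξκ-primitive , gen (inj₁ ≡.refl)) A₅.≈ π →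
                  f (S K ξκ-primitive ξλ , gen (inj₂ ≡.refl)) A₅.≈ τ → EqualTraces π τ
    equalTraces {π} {τ} fR≈π fS≈τ =
      All.map (λ {w} scalar → from (transport w) (trivial {⟨R,S⟩.⟦ w ⟧} (word◃ w) scalar)) relators-scalar ,
      All.map (λ {w} nonscalar w≈ε → nontrivial {⟨R,S⟩.⟦ w ⟧} (word◃ w) nonscalar (to (transport w) w≈ε))
        nonrelators-nonscalar
      where
      transport : ∀ w → Words.⟦_⟧ A₅ π τ w A₅.≈ A₅.ε ⇔ ⟨R,S⟩.⟦ w ⟧ PGL.≈ PGL.ε
      transport = trivial-word⇔ (PGL₂ K) A₅ f (GroupMorphisms.IsGroupIsomorphism.isGroupMonomorphism f-iso) {π} {τ} fR≈π fS≈τ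

proposition5p1 : ∀ {c ℓ₁ ℓ₂ ℓ ℓ′ : Level} (p q k : ℕ) →
    Prime p → 2 ∤ p → p ≢ 5 →
    1 ≤ k → q ≡ p ^ k →
    (K : DiscreteField c ℓ₁ ℓ₂) → IsAlgebraicClosureOfGF K p →
    let open DiscreteField K hiding (_^_) in
    (GFq : Pred Carrier ℓ) → IsGF K q GFq →
    (GFq² : Pred Carrier ℓ′) → IsGF K (q ^ 2) GFq² →
    (ξκ ξλ : Carrier) →
    (ξκ-primitive : IsPrimitiveRoot K 10 ξκ) → IsPrimitiveRoot K 10 ξλ →
    ξκ ∈ GFq ⊎ ξκ ∈ GFq² → ξλ ∈ GFq ⊎ ξλ ∈ GFq² →
    ⟨ PGL₂ K ∣ R K ξκ-primitive , S K ξκ-primitive ξλ ⟩ ≅ Alternating 5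
    ⇔ (¬ (ω K ξλ ≈ ω K ξκ))
proposition5p1 _ _ _ _ _ _ _ _ K _ _ _ _ _ _ _ ξκ-primitive ξλ-primitive _ _ =
  mk⇔ (A₅⇒distinct K ξκ-primitive ξλ-primitive) (distinct⇒A₅ K ξκ-primitive ξλ-primitive)
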